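{- Let $\boldsymbol\lambda,\mathbf d,n$ be as in the context and $A=A_{\boldsymbol\lambda,\mathbf d}$, $\Delta_A=\Delta(Q_{n\times n},A)$. (1) The map $\Phi_{\boldsymbol\lambda,\mathbf d}$ restricts to a weight preserving bijection from ${\tt StableFacet}(\boldsymbol\lambda,\mathbf d)$ onto the set $F(\Delta_A)$ of facets of $\Delta_A$. (2) This bijection restricts to a bijection from ${\tt Prism}(\boldsymbol\lambda,\mathbf d)$ onto $F_{\tt max}(\Delta_A)$, the set of faces of $\Delta_A$ of maximum dimension.
   Context: $\boldsymbol\lambda=(\lambda^{(1)},\ldots,\lambda^{(k)})$ partitions, $\mathbf d=(d_1,\ldots,d_k)$ positive integers with $\ell(\lambda^{(i)})\le d_i$, $n$ with $\lambda^{(i)}_1\le n-d_i$. ASMs: square matrices with entries in $\{ -1,0,1\}$, nonzero entries alternating in sign along rows and columns, row and column sums 1; $A\le B$ iff $r_A\ge r_B$ entrywise where $r_A(i,j)=\sum_{k\le i,l\le j}a_{kl}$; join = ASM with entrywise-minimum corner sums; permutations identified with permutation matrices (1 at $(i,w(i))$). $[\lambda,d]_g\in\mathcal S_n$: $u(t)=\lambda_{d-t+1}+t$ for $t\le d$, $u(d+1)<\cdots<u(n)$ (identity if $\lambda=\emptyset$). $A_{\boldsymbol\lambda,\mathbf d}=\vee\{[\lambda^{(i)},d_i]_g\}$. Prism tableaux (matrix coordinates, row $a$ from top): $\lambda^{(c)}$ occupies cells $\{(a,b):1\le a\le d_c,\ 1\le b\le\lambda^{(c)}_{d_c-a+1}\}$;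 a prism tableau $\mathcal T=(T^{(1)},\ldots,T^{(k)})$ fills each with integers in $\{1,\ldots,d_c\}$ (color $c$) weakly decreasing along rows left to right and strictly decreasing up columns. ${\tt wt}(\mathcal T)=\prod_m x_m^{n_m}$, $n_m$ = number of antidiagonals $\{a+b=s\}$ containing an entry $m$. Minimal: total degree of weight equals the minimum over all prism tableaux for $(\boldsymbol\lambda,\mathbf d)$. Unstable triple: in one antidiagonal, an entry $\ell$ of color $c$, another entry $\ell$ of color $d\ne c$, and an entry $\ell'>\ell$, such that replacing that entry $\ell$ of color $c$ by $\ell'$ gives a prism tableau. ${\tt Prism}(\boldsymbol\lambda,\mathbf d)$: minimal prism tableaux without unstable triples. Square word $Q_{n\times n}=s_n\cdots s_1\ s_{n+1}\cdots s_2\cdots s_{2n-1}\cdots s_n$ (simple transpositions of $\mathcal S_{2n}$), letters identified with cells of the $n\times n$ grid, cell $(i,j)\leftrightarrow s_{i+j-1}$, read rows top to bottom, each row right to left; subwords $P$ ↔ sets of cells; $F_P$ = complement of $P$. $\Delta(Q,A)=\{F_P:\delta(P)\ge A\}$ with $\delta$ the Demazure product ($e_we_s=e_{ws}$ if $\ell(ws)>\ell(w)$, else $e_w$); facets are maximal faces. ${\tt wt}(F_P)=\prod_i x_i^{n_i}$, $n_i$ = number of cells of $P$ in row $i$. $P_{\mathcal T}$ = set of cells $(t,a+b-t)$ over all entries $t$ in cells $(a,b)$ of all components; $\Phi_{\boldsymbol\lambda,\mathbf d}(\mathcal T)=F_{P_{\mathcal T}}\in\Delta_A$. $\mathcal T$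 is a facet prism tableau if $\Phi_{\boldsymbol\lambda,\mathbf d}(\mathcal T)\in F(\Delta_A)$; ${\tt StableFacet}(\boldsymbol\lambda,\mathbf d)$ is the set of facet prism tableaux with no unstable triple. -}

module Defs where

open import Data.Nat using (ℕ; zero; suc; _+_; _*_; _∸_; _≤_; _<_; _⊓_; _≡ᵇ_; _<ᵇ_; _≤ᵇ_)
open import Data.Bool using (Bool; true; false; not; if_then_else_; _∧_; _∨_)
import Data.Bool as B
open import Data.Integer as ℤ using (ℤ; +_)
open import Data.List using (List; []; _∷_; length; map; concatMap; filterᵇ; foldl; foldr; reverse; upTo; deduplicateᵇ; zip)
open import Data.Bool.ListAction using (any)
open import Data.Nat.ListAction using (sum)
open import Data.List.Relation.Unary.All using (All)
open import Data.List.Relation.Unary.Linked using (Linked)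
open import Data.List.Relation.Binary.Pointwise using (Pointwise)
open import Data.List.Membership.Propositional using (_∈_)
open import Data.Product using (_×_; _,_; Σ; ∃; proj₁; proj₂)
open import Relation.Binary.PropositionalEquality using (_≡_; _≢_)
open import Relation.Nullary using (¬_)

-- Basic list helpers (all indices 1-based, defaults outside the range)

[1…] : ℕ → List ℕ
[1…] n = map suc (upTo n)

nth : {A : Set} → A → List A → ℕ → A
nth d []       _             = d
nth d (x ∷ xs) zero          = d
nth d (x ∷ xs) (suc zero)    = x
nth d (x ∷ xs) (suc (suc i)) = nth d xs (suc i)

modifyAt : {A : Set} → ℕ → (A → A) → List A → List A
modifyAt _             f []       = []
modifyAt zero          f xs       = xs
modifyAt (suc zero)    f (x ∷ xs) = f x ∷ xs
modifyAt (suc (suc i)) f (x ∷ xs) = x ∷ modifyAt (suc i) f xs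

enum : {A : Set} → List A → List (ℕ × A)
enum xs = zip ([1…] (length xs)) xs

countᵇ : {A : Set} → (A → Bool) → List A → ℕ
countᵇ p xs = length (filterᵇ p xs)

memℕ : ℕ → List ℕ → Bool
memℕ x = any (λ y → x ≡ᵇ y)

memℕ² : ℕ × ℕ → List (ℕ × ℕ) → Bool
memℕ² (x , y) = any (λ p → (x ≡ᵇ proj₁ p) ∧ (y ≡ᵇ proj₂ p))

-- Partitions: lists of positive parts, weakly decreasing.
-- ℓ(λ) = length λ,  λ_j = partAt λ j  (0 for j > ℓ(λ) or j = 0)

IsPartition : List ℕ → Set
IsPartition λ′ = Linked (λ x y → y ≤ x) λ′ × All (λ x → 1 ≤ x) λ′

partAt : List ℕ → ℕ → ℕ
partAt = nth 0

-- Permutations of {1,…,N} as functions ℕ → ℕ (one-line notation).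
-- The permutation matrix of w has a 1 at (i, w(i)); its corner sum is
-- r_w(i,j) = #{ k ≤ i : w(k) ≤ j }.

cornerPerm : (ℕ → ℕ) → ℕ → ℕ → ℕ
cornerPerm w i j = countᵇ (λ k → w k ≤ᵇ j) ([1…] i)

-- The Grassmannian permutation [λ,d]_g ∈ S_n:
-- u(t) = λ_{d-t+1} + t for 1 ≤ t ≤ d, and u(d+1) < ⋯ < u(n) are the
-- remaining values of {1,…,n} in increasing order.
grassFirst : List ℕ → ℕ → List ℕ
grassFirst λ′ d = map (λ t → partAt λ′ (suc (d ∸ t)) + t) ([1…] d)

grassPerm : List ℕ → ℕ → ℕ → ℕ → ℕ
grassPerm λ′ d n t =
  if t ≤ᵇ d then partAt λ′ (suc (d ∸ t)) + t
  else nth 0 (filterᵇ (λ v → not (memℕ v (grassFirst λ′ d))) ([1…] n)) (t ∸ d)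

-- The data (λ,d) is a list of pairs (λ^(c), d_c), c = 1,…,k.

Data : Set
Data = List (List ℕ × ℕ)

minList : List ℕ → ℕ
minList []       = 0
minList (x ∷ []) = x
minList (x ∷ xs@(_ ∷ _)) = x ⊓ minList xs

joinCorner : ℕ → Data → ℕ → ℕ → ℕ
joinCorner n D i j = minList (map (λ p → cornerPerm (grassPerm (proj₁ p) (proj₂ p) n) i j) D)

-- the entries of the n×n matrix A_{λ,d} (the ASM whose corner sums are
-- joinCorner), recovered by inclusion–exclusion; indices 1-based
joinEntry : ℕ → Data → ℕ → ℕ → ℤ
joinEntry n D i j =
  (+ r i j ℤ.- + r (i ∸ 1) j) ℤ.- (+ r i (j ∸ 1) ℤ.- + r (i ∸ 1) (j ∸ 1))
  where r = joinCorner n D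

plusIdEntry : ℕ → Data → ℕ → ℕ → ℤ
plusIdEntry n D i j =
  if (i ≤ᵇ n) ∧ (j ≤ᵇ n) then joinEntry n D i j
  else (if (n <ᵇ i) ∧ (i ≡ᵇ j) then + 1 else + 0)

sumℤ : List ℤ → ℤ
sumℤ = foldr ℤ._+_ (+ 0)

plusIdCorner : ℕ → Data → ℕ → ℕ → ℤ
plusIdCorner n D i j =
  sumℤ (concatMap (λ k → map (λ l → plusIdEntry n D k l) ([1…] j)) ([1…] i))

-- The square word Q_{n×n} in S_{2n}: cells (i,j) of the n×n grid, read
-- rows top to bottom, each row right to left; cell (i,j) ↔ s_{i+j-1}.

cellsQ : ℕ → List (ℕ × ℕ)
cellsQ n = concatMap (λ i → map (λ j → (i , j)) (reverse ([1…] n))) ([1…] n)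

-- A face / subword is encoded as a mask: a list of Booleans of length n*n,
-- aligned with cellsQ n (true = the cell/letter belongs to the set).
Mask : Set
Mask = List Bool

selected : ℕ → Mask → List (ℕ × ℕ)
selected n F = map proj₁ (filterᵇ proj₂ (zip (cellsQ n) F))

complement : Mask → Mask
complement = map not

-- one Demazure step e_w e_{s_m}: w ↦ w s_m if ℓ(w s_m) > ℓ(w), i.e. if
-- w(m) < w(m+1); otherwise w.
swapAt : (ℕ → ℕ) → ℕ → ℕ → ℕ
swapAt w m x = if x ≡ᵇ m then w (suc m) else (if x ≡ᵇ suc m then w m else w x)

demazureStep : (ℕ → ℕ) → ℕ → (ℕ → ℕ)
demazureStep w m = if w m <ᵇ w (suc m) then swapAt w m else w

demazure : ℕ → Mask → ℕ → ℕ
demazure n P = foldl demazureStep (λ x → x)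
                 (map (λ c → (proj₁ c + proj₂ c) ∸ 1) (selected n P))

-- δ(P) ≥ A  (Bruhat order on 2n×2n ASMs, A embedded as A ⊕ I_n):
-- r_{δ(P)} ≤ r_{A⊕I} entrywise
DemazureGE : ℕ → Data → Mask → Set
DemazureGE n D P = ∀ i j → 1 ≤ i → i ≤ 2 * n → 1 ≤ j → j ≤ 2 * n →
  (+ cornerPerm (demazure n P) i j) ℤ.≤ plusIdCorner n D i j

IsFace : ℕ → Data → Mask → Set
IsFace n D F = length F ≡ n * n × DemazureGE n D (complement F)

_⊆ₘ_ : Mask → Mask → Set
F ⊆ₘ G = Pointwise B._≤_ F G

IsFacet : ℕ → Data → Mask → Set
IsFacet n D F = IsFace n D F × (∀ G → IsFace n D G → F ⊆ₘ G → G ≡ F)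

-- faces of maximum dimension (dimension = #F - 1)
IsMaxFace : ℕ → Data → Mask → Set
IsMaxFace n D F = IsFace n D F × (∀ G → IsFace n D G → countᵇ (λ b → b) G ≤ countᵇ (λ b → b) F)

-- wt(F_P) = ∏ x_i^{n_i}, n_i = #cells of P in row i; we give the exponent of x_m
wtF : ℕ → Mask → ℕ → ℕ
wtF n F m = countᵇ (λ c → proj₁ c ≡ᵇ m) (selected n (complement F))

-- Prism tableaux.  A filling of λ^(c) is a list of d_c rows (row a = 1 at
-- the top); row a is the list of entries in columns 1,…,λ^(c)_{d_c-a+1}.

Filling : Set
Filling = List (List ℕ)

rowOf : Filling → ℕ → List ℕ
rowOf = nth []

at : Filling → ℕ → ℕ → ℕ
at T a b = nth 0 (rowOf T a) b

InShape : List ℕ → ℕ → ℕ → ℕ → Set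
InShape λ′ d a b = 1 ≤ a × a ≤ d × 1 ≤ b × b ≤ partAt λ′ (suc (d ∸ a))

IsFilling : List ℕ → ℕ → Filling → Set
IsFilling λ′ d T =
  length T ≡ d ×
  (∀ a → 1 ≤ a → a ≤ d → length (rowOf T a) ≡ partAt λ′ (suc (d ∸ a))) ×
  (∀ a b → InShape λ′ d a b → 1 ≤ at T a b × at T a b ≤ d) ×
  (∀ a b → InShape λ′ d a b → InShape λ′ d a (suc b) → at T a (suc b) ≤ at T a b) ×
  (∀ a b → InShape λ′ d a b → InShape λ′ d (suc a) b → at T a b < at T (suc a) b)

PrismTab : Set
PrismTab = List Filling

IsPrismTableau : Data → PrismTab → Set
IsPrismTableau D 𝒯 = Pointwise (λ p T → IsFilling (proj₁ p) (proj₂ p) T) D 𝒯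

record Entry : Set where
  constructor entry
  field
    color row col val : ℕ
open Entry public

entries : PrismTab → List Entry
entries 𝒯 =
  concatMap (λ cT → concatMap (λ aR → map (λ bv → entry (proj₁ cT) (proj₁ aR) (proj₁ bv) (proj₂ bv))
                                            (enum (proj₂ aR)))
                              (enum (proj₂ cT)))
            (enum 𝒯)

antidiag : Entry → ℕ
antidiag e = row e + col e

-- exponent of x_m in wt(𝒯): number of antidiagonals containing an entry m
wtT : PrismTab → ℕ → ℕ
wtT 𝒯 m = length (deduplicateᵇ _≡ᵇ_ (map antidiag (filterᵇ (λ e → val e ≡ᵇ m) (entries 𝒯))))

totalDeg : PrismTab → ℕ
totalDeg 𝒯 = sum (map (wtT 𝒯) (deduplicateᵇ _≡ᵇ_ (map val (entries 𝒯))))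

IsMinimal : Data → PrismTab → Set
IsMinimal D 𝒯 = ∀ 𝒯′ → IsPrismTableau D 𝒯′ → totalDeg 𝒯 ≤ totalDeg 𝒯′

replace : PrismTab → ℕ → ℕ → ℕ → ℕ → PrismTab
replace 𝒯 c a b v = modifyAt c (modifyAt a (modifyAt b (λ _ → v))) 𝒯

HasUnstableTriple : Data → PrismTab → Set
HasUnstableTriple D 𝒯 =
  Σ Entry λ e₁ → Σ Entry λ e₂ → Σ Entry λ e₃ →
    e₁ ∈ entries 𝒯 × e₂ ∈ entries 𝒯 × e₃ ∈ entries 𝒯 ×
    antidiag e₁ ≡ antidiag e₂ × antidiag e₁ ≡ antidiag e₃ ×
    val e₁ ≡ val e₂ × color e₁ ≢ color e₂ × val e₁ < val e₃ ×
    IsPrismTableau D (replace 𝒯 (color e₁) (row e₁) (col e₁) (val e₃))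

IsPrism : Data → PrismTab → Set
IsPrism D 𝒯 = IsPrismTableau D 𝒯 × IsMinimal D 𝒯 × ¬ HasUnstableTriple D 𝒯

Pcells : PrismTab → List (ℕ × ℕ)
Pcells 𝒯 = map (λ e → (val e , antidiag e ∸ val e)) (entries 𝒯)

Φ : ℕ → PrismTab → Mask
Φ n 𝒯 = map (λ c → not (memℕ² c (Pcells 𝒯))) (cellsQ n)

IsStableFacet : ℕ → Data → PrismTab → Set
IsStableFacet n D 𝒯 = IsPrismTableau D 𝒯 × IsFacet n D (Φ n 𝒯) × ¬ HasUnstableTriple D 𝒯

ValidData : ℕ → Data → Set
ValidData n D = D ≢ [] ×
  All (λ p → IsPartition (proj₁ p) × 1 ≤ proj₂ p × length (proj₁ p) ≤ proj₂ p
             × partAt (proj₁ p) 1 + proj₂ p ≤ n) D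

{-# OPTIONS --safe #-}
module Submission where

-- A mask P satisfies δ(P) ≥ A iff P contains the cells of a prism tableau.  By the Grassmannian
-- shape of [λ,d]_g, the corner sum condition for one color only concerns the values at the
-- positions 1,…,d of δ(P), and these are governed by the left action of P on d-subsets: reading
-- the word backwards, the particles 1,…,d jump to the right.  The b-th jump of particle a happens
-- in row T(a,b), where T is the greedy filling, i.e. the entrywise largest filling of λ within P;
-- so the condition says that T has the required shape.
-- For a facet, the tuple of greedy fillings uses exactly the cells of P and cannot be raised,
-- hence has no unstable triple.  Conversely two stable facet tableaux over the same facet agree:
-- at a bottom-left-most difference the smaller entry could be raised to the larger one.  Finally
-- the degree of a tableau is its number of cells, so minimal tableaux match faces of maximum
-- dimension.

open import Defs
open import Data.Bool using (Bool; true; false; not; if_then_else_; _∧_; T; T?)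
import Data.Bool as B
open import Data.Bool.Properties using (T-∧; T-≡; not-involutive; ∧-zeroʳ)
open import Data.Empty using (⊥; ⊥-elim)
open import Data.Unit using (tt)
import Data.Integer as ℤ
import Data.Integer.Properties as ℤₚ
open import Data.List using (List; []; _∷_; _++_; _∷ʳ_; length; map; concatMap; filterᵇ; foldl; foldr; reverse; upTo; applyUpTo; deduplicateᵇ; zip)
open import Data.List.Properties hiding (≡-dec)
open import Data.List.Membership.Propositional using (_∈_; find; lose)
open import Data.List.Membership.Propositional.Properties
open import Data.List.Relation.Unary.All as All using (All; []; _∷_)
import Data.List.Relation.Unary.All.Properties as Allₚ
open import Data.List.Relation.Unary.Any as Any using (Any; here; there)
import Data.List.Relation.Unary.Any.Properties as Anyₚ
open import Data.List.Relation.Unary.Linked using ([]; _∷_)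
open import Data.List.Relation.Unary.AllPairs using ([]; _∷_)
open import Data.List.Relation.Unary.Unique.Propositional using (Unique)
import Data.List.Relation.Unary.Unique.Propositional.Properties as Uniqueₚ
open import Data.List.Relation.Binary.Pointwise using (Pointwise; []; _∷_)
open import Data.Nat using (ℕ; zero; suc; pred; _+_; _*_; _∸_; _≤_; _<_; _⊓_; _≡ᵇ_; _<ᵇ_; _≤ᵇ_; z≤n; s≤s; z<s; s≤s⁻¹; _≟_; _≤?_; _<?_)
open import Data.Nat.Properties hiding (_≟_; _≤?_; _<?_)
open import Data.Nat.ListAction using (sum)
open import Algebra.Properties.CommutativeSemigroup +-commutativeSemigroup using (interchange)
open import Data.Product using (_×_; _,_; ∃; proj₁; proj₂)
open import Data.Product.Properties using (,-injective; ≡-dec)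
open import Data.Sum using (_⊎_; inj₁; inj₂)
open import Function using (_∘_; id; _⇔_; mk⇔; Equivalence)
open import Function.Properties.Equivalence using () renaming (trans to ⇔-trans; refl to ⇔-refl)
open import Relation.Nullary using (¬_; Dec; yes; no; contradiction)
open import Relation.Binary.Definitions using (tri<; tri≈; tri>)
open import Relation.Binary.PropositionalEquality
open Equivalence using (to; from)

-- Demazure products and corner sums

-- The obstacle is that `demazure` multiplies on the right and changes a whole permutation, while
-- the particles see a left action on d-subsets. Both are recorded by counts: `above w j l` for the
-- values of w exceeding j, and f l for the particles beyond l. One right step and one left step are
-- adjoint for the pairing given by the minimum over l of f l + g l, so letters can be carried
-- across one at a time. Particles and entries are matched by thresholds. The particle with k others
-- in front of it starts at d - k. If suc j + k = d + b, then `suc k ≤ f j` says that it has made at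
-- least b jumps, and `t ≤ greedy k b` says that its b-th jump lies in row t or lower. Rows are read
-- from the bottom, so early jumps are large entries, and jumping as soon as possible yields the
-- largest filling. A row is read from column 1 on: a particle may jump repeatedly in it, which
-- makes the rows of the filling weak, while the particle in front must have moved away in a lower
-- row, which makes the columns strict.

bit : Bool → ℕ
bit b = if b then 1 else 0

[1…]-suc : ∀ n → [1…] (suc n) ≡ [1…] n ∷ʳ suc n
[1…]-suc n = trans (cong (map suc) (sym (upTo-∷ʳ n))) (map-++ suc (upTo n) _)

countᵇ-++ : ∀ {A : Set} (p : A → Bool) xs ys → countᵇ p (xs ++ ys) ≡ countᵇ p xs + countᵇ p ys
countᵇ-++ p xs ys = trans (cong length (filter-++ (T? ∘ p) xs ys)) (length-++ (filterᵇ p xs))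

countᵇ-∷ : ∀ {A : Set} (p : A → Bool) x xs → countᵇ p (x ∷ xs) ≡ bit (p x) + countᵇ p xs
countᵇ-∷ p x xs with p x
... | true  = refl
... | false = refl

countᵇ-[1…]-suc : ∀ p n → countᵇ p ([1…] (suc n)) ≡ countᵇ p ([1…] n) + bit (p (suc n))
countᵇ-[1…]-suc p n = begin
  countᵇ p ([1…] (suc n))                     ≡⟨ cong (countᵇ p) ([1…]-suc n) ⟩
  countᵇ p ([1…] n ∷ʳ suc n)                  ≡⟨ countᵇ-++ p ([1…] n) _ ⟩
  countᵇ p ([1…] n) + countᵇ p (suc n ∷ [])   ≡⟨ cong (countᵇ p ([1…] n) +_) (countᵇ-∷ p (suc n) []) ⟩
  countᵇ p ([1…] n) + (bit (p (suc n)) + 0)   ≡⟨ cong (countᵇ p ([1…] n) +_) (+-identityʳ _) ⟩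
  countᵇ p ([1…] n) + bit (p (suc n))         ∎
  where open ≡-Reasoning

≤ᵇ-true : ∀ {x y} → x ≤ y → (x ≤ᵇ y) ≡ true
≤ᵇ-true = to T-≡ ∘ ≤⇒≤ᵇ

≤ᵇ-false : ∀ {x y} → y < x → (x ≤ᵇ y) ≡ false
≤ᵇ-false {x} {y} y<x with x ≤ᵇ y in eq
... | false = refl
... | true  = contradiction (≤ᵇ⇒≤ x y (from T-≡ eq)) (<⇒≱ y<x)

<ᵇ-true : ∀ {x y} → x < y → (x <ᵇ y) ≡ true
<ᵇ-true = to T-≡ ∘ <⇒<ᵇ

<ᵇ-false : ∀ {x y} → y ≤ x → (x <ᵇ y) ≡ false
<ᵇ-false {x} {y} y≤x with x <ᵇ y in eq
... | false = refl
... | true  = contradiction (<ᵇ⇒< x y (from T-≡ eq)) (≤⇒≯ y≤x)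

≡ᵇ-true : ∀ {x y} → x ≡ y → (x ≡ᵇ y) ≡ true
≡ᵇ-true {x} {y} = to T-≡ ∘ ≡⇒≡ᵇ x y

≡ᵇ-false : ∀ {x y} → x ≢ y → (x ≡ᵇ y) ≡ false
≡ᵇ-false {x} {y} x≢y with x ≡ᵇ y in eq
... | false = refl
... | true  = contradiction (≡ᵇ⇒≡ x y (from T-≡ eq)) x≢y

-- Complement in l of the corner sum `cornerPerm w l j`. The argument j comes first so that
-- `above w j` is a function of l alone, ready to be paired with a particle count.
above : (ℕ → ℕ) → ℕ → ℕ → ℕ
above w j zero    = 0
above w j (suc l) = above w j l + (if w (suc l) ≤ᵇ j then 0 else 1)

cornerPerm+above : ∀ w l j → cornerPerm w l j + above w j l ≡ l
cornerPerm+above w zero    j = refl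
cornerPerm+above w (suc l) j
  rewrite countᵇ-[1…]-suc (λ k → w k ≤ᵇ j) l with w (suc l) ≤ᵇ j
... | true  = begin
  cornerPerm w l j + 1 + (above w j l + 0)  ≡⟨ cong₂ _+_ (+-comm (cornerPerm w l j) 1) (+-identityʳ (above w j l)) ⟩
  suc (cornerPerm w l j + above w j l)      ≡⟨ cong suc (cornerPerm+above w l j) ⟩
  suc l                                     ∎
  where open ≡-Reasoning
... | false = begin
  cornerPerm w l j + 0 + (above w j l + 1)  ≡⟨ cong₂ _+_ (+-identityʳ (cornerPerm w l j)) (+-comm (above w j l) 1) ⟩
  cornerPerm w l j + suc (above w j l)      ≡⟨ +-suc _ _ ⟩
  suc (cornerPerm w l j + above w j l)      ≡⟨ cong suc (cornerPerm+above w l j) ⟩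
  suc l                                     ∎
  where open ≡-Reasoning

above-≤-suc : ∀ w j l → above w j l ≤ above w j (suc l)
above-≤-suc w j l = m≤m+n _ _

above-suc-≤ : ∀ w j l → above w j (suc l) ≤ suc (above w j l)
above-suc-≤ w j l with w (suc l) ≤ᵇ j
... | true  = ≤-trans (≤-reflexive (+-identityʳ _)) (n≤1+n _)
... | false = ≤-reflexive (+-comm _ 1)

above-≤-+ : ∀ w j d l → above w j d ≤ (d ∸ l) + above w j l
above-≤-+ w j zero    l = z≤n
above-≤-+ w j (suc d) l with l ≤? d
... | yes l≤d = begin
  above w j (suc d)            ≤⟨ above-suc-≤ w j d ⟩
  suc (above w j d)            ≤⟨ s≤s (above-≤-+ w j d l) ⟩
  suc (d ∸ l) + above w j l    ≡⟨ cong (_+ above w j l) (+-∸-assoc 1 l≤d) ⟨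
  (suc d ∸ l) + above w j l    ∎
  where open ≤-Reasoning
... | no l≰d = ≤-trans (mono (≰⇒> l≰d)) (m≤n+m _ _)
  where
  mono′ : ∀ e → above w j (suc d) ≤ above w j (e + suc d)
  mono′ zero    = ≤-refl
  mono′ (suc e) = ≤-trans (mono′ e) (above-≤-suc w j (e + suc d))
  mono : suc d ≤ l → above w j (suc d) ≤ above w j l
  mono d<l = subst (λ x → above w j (suc d) ≤ above w j x) (m∸n+n≡m d<l) (mono′ (l ∸ suc d))

above-cong : ∀ {w w′} j l → (∀ k → k ≤ l → w k ≡ w′ k) → above w j l ≡ above w′ j l
above-cong j zero    h = refl
above-cong j (suc l) h =
  cong₂ (λ x y → x + (if y ≤ᵇ j then 0 else 1)) (above-cong j l (λ k → h k ∘ m≤n⇒m≤1+n)) (h (suc l) ≤-refl)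

above-id : ∀ j l → above id j l ≡ l ∸ j
above-id j zero    = sym (0∸n≡0 j)
above-id j (suc l) with suc l ≤? j
... | yes l<j rewrite ≤ᵇ-true l<j | above-id j l | m≤n⇒m∸n≡0 l<j | m≤n⇒m∸n≡0 (<⇒≤ l<j) = refl
... | no  l≮j rewrite ≤ᵇ-false (≰⇒> l≮j) | above-id j l =
  trans (+-comm _ 1) (sym (+-∸-assoc 1 (s≤s⁻¹ (≰⇒> l≮j))))

swapAt-here : ∀ w m → swapAt w m m ≡ w (suc m)
swapAt-here w m rewrite ≡ᵇ-true {m} refl = refl

swapAt-next : ∀ w m → swapAt w m (suc m) ≡ w m
swapAt-next w m rewrite ≡ᵇ-false (1+n≢n {m}) | ≡ᵇ-true {m} refl = refl

swapAt-other : ∀ w m x → x ≢ m → x ≢ suc m → swapAt w m x ≡ w x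
swapAt-other w m x x≢m x≢1+m rewrite ≡ᵇ-false x≢m | ≡ᵇ-false x≢1+m = refl

-- The first l values are merely permuted unless l separates the two swapped positions.
above-swapAt : ∀ w m j l → l ≢ suc m → above (swapAt w (suc m)) j l ≡ above w j l
above-swapAt w m j l l≢1+m with <-cmp l (suc m)
... | tri< l<1+m _ _ = above-cong j l λ k k≤l →
  swapAt-other w (suc m) k (<⇒≢ (≤-<-trans k≤l l<1+m)) (<⇒≢ (≤-<-trans k≤l (m≤n⇒m≤1+n l<1+m)))
... | tri≈ _ l≡1+m _ = contradiction l≡1+m l≢1+m
... | tri> _ _ l>1+m = subst (λ x → above (swapAt w (suc m)) j x ≡ above w j x) (m∸n+n≡m l>1+m) (beyond (l ∸ suc (suc m)))
  where
  beyond : ∀ e → above (swapAt w (suc m)) j (e + suc (suc m)) ≡ above w j (e + suc (suc m))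
  beyond zero
    rewrite swapAt-here w (suc m) | swapAt-next w (suc m)
          | above-cong {swapAt w (suc m)} {w} j m (λ k k≤m →
              swapAt-other w (suc m) k (<⇒≢ (s≤s k≤m)) (<⇒≢ (m≤n⇒m≤1+n (s≤s k≤m))))
    = begin
      a + b + c    ≡⟨ +-assoc a b c ⟩
      a + (b + c)  ≡⟨ cong (a +_) (+-comm b c) ⟩
      a + (c + b)  ≡⟨ +-assoc a c b ⟨
      a + c + b    ∎
    where
    open ≡-Reasoning
    a = above w j m
    b = if w (suc (suc m)) ≤ᵇ j then 0 else 1
    c = if w (suc m) ≤ᵇ j then 0 else 1
  beyond (suc e) = cong₂ (λ x y → x + (if y ≤ᵇ j then 0 else 1)) (beyond e)
    (swapAt-other w (suc m) _ (>⇒≢ (s≤s (≤-trans (n≤1+n _) (m≤n+m _ e)))) (>⇒≢ (s≤s (m≤n+m _ e))))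

above-demazureStep : ∀ w m j l → l ≢ suc m → above (demazureStep w (suc m)) j l ≡ above w j l
above-demazureStep w m j l l≢ with w (suc m) <ᵇ w (suc (suc m))
... | true  = above-swapAt w m j l l≢
... | false = refl

demazureStep-max : ∀ w m → w m ≤ demazureStep w m m × w (suc m) ≤ demazureStep w m m
demazureStep-max w m with w m <? w (suc m)
... | yes lt rewrite <ᵇ-true lt = subst (λ x → w m ≤ x × w (suc m) ≤ x) (sym (swapAt-here w m)) (<⇒≤ lt , ≤-refl)
... | no ¬lt rewrite <ᵇ-false (≮⇒≥ ¬lt) = ≤-refl , ≮⇒≥ ¬lt

-- The larger of the two values ends up at position m + 1. Either it exceeds j and adds one to the
-- count at m, or neither value exceeds j and the count at m + 2 is that at m. So the new count is
-- at least the minimum of the two, the mirror image of the formula in `stepF`.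
above-at-step : ∀ w m j →
  suc (above w j m) ≤ above (demazureStep w (suc m)) j (suc m) ⊎
  above w j (suc (suc m)) ≤ above (demazureStep w (suc m)) j (suc m)
above-at-step w m j with demazureStep w (suc m) (suc m) ≤? j
... | no  w′≰j = inj₁ (≤-reflexive (trans (sym (+-comm _ 1))
  (cong₂ (λ x y → x + (if y then 0 else 1)) (sym (above-demazureStep w m j m (<⇒≢ (n<1+n m)))) (sym (≤ᵇ-false (≰⇒> w′≰j))))))
... | yes w′≤j = inj₂ (begin
  above w j m + (if w (suc m) ≤ᵇ j then 0 else 1) + (if w (suc (suc m)) ≤ᵇ j then 0 else 1)
    ≡⟨ cong₂ (λ x y → above w j m + (if x then 0 else 1) + (if y then 0 else 1))
         (≤ᵇ-true (≤-trans (proj₁ (demazureStep-max w (suc m))) w′≤j))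
         (≤ᵇ-true (≤-trans (proj₂ (demazureStep-max w (suc m))) w′≤j)) ⟩
  above w j m + 0 + 0                           ≡⟨ trans (+-identityʳ _) (+-identityʳ _) ⟩
  above w j m                                   ≡⟨ above-demazureStep w m j m (<⇒≢ (n<1+n m)) ⟨
  above (demazureStep w (suc m)) j m            ≤⟨ above-≤-suc (demazureStep w (suc m)) j m ⟩
  above (demazureStep w (suc m)) j (suc m)      ∎)
  where open ≤-Reasoning

-- If f l = #{x ∈ S : x > l} for a set S of positions, stepF m f is the same count after
-- the left action of s_m, which moves an element m of S to m + 1 when m + 1 is free.
stepF : ℕ → (ℕ → ℕ) → ℕ → ℕ
stepF m f l = if l ≡ᵇ m then f (pred l) ⊓ suc (f (suc l)) else f l

stepF-here : ∀ m f → stepF m f m ≡ f (pred m) ⊓ suc (f (suc m))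
stepF-here m f rewrite ≡ᵇ-true {m} refl = refl

stepF-other : ∀ m f l → l ≢ m → stepF m f l ≡ f l
stepF-other m f l l≢m rewrite ≡ᵇ-false l≢m = refl

-- What is retained of a count of the elements of S beyond l: moving l up by one loses at most one
-- element.
Descends : (ℕ → ℕ) → Set
Descends f = ∀ l → f (suc l) ≤ f l × f l ≤ suc (f (suc l))

stepF-descends : ∀ m f → Descends f → Descends (stepF (suc m) f)
stepF-descends m f h l with l ≟ suc m
... | yes refl rewrite stepF-here (suc m) f | stepF-other (suc m) f (suc (suc m)) 1+n≢n =
  ⊓-glb (≤-trans (proj₁ (h (suc m))) (proj₁ (h m))) (n≤1+n _) , m⊓n≤n _ _
... | no l≢1+m with l ≟ m
...   | yes refl rewrite stepF-here (suc m) f | stepF-other (suc m) f m (<⇒≢ (n<1+n m)) =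
  m⊓n≤m (f m) _ , ⊓-glb {x = f m} (n≤1+n _) (≤-trans (proj₂ (h m)) (s≤s (proj₂ (h (suc m)))))
...   | no l≢m rewrite stepF-other (suc m) f l l≢1+m | stepF-other (suc m) f (suc l) (l≢m ∘ suc-injective) = h l

foldr-stepF-descends : ∀ W f → All (1 ≤_) W → Descends f → Descends (foldr stepF f W)
foldr-stepF-descends []          f []         h = h
foldr-stepF-descends (suc m ∷ W) f (_ ∷ 1≤W) h = stepF-descends m _ (foldr-stepF-descends W f 1≤W h)

-- A lower bound q for the min-plus pairing of f and g. Working with all bounds q avoids forming the
-- minimum.
Dominates : ℕ → (ℕ → ℕ) → (ℕ → ℕ) → Set
Dominates q f g = ∀ l → q ≤ f l + g l

-- Left and right action of s_m are adjoint: both sides say q ≤ f l + above w j l for all l ≠ m.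
step-adjoint : ∀ q f w m j → Descends f →
  Dominates q (stepF (suc m) f) (above w j) ⇔ Dominates q f (above (demazureStep w (suc m)) j)
step-adjoint q f w m j h = mk⇔ fwd bwd
  where
  w′ = demazureStep w (suc m)
  off : Dominates q (stepF (suc m) f) (above w j) → ∀ l → l ≢ suc m → q ≤ f l + above w j l
  off dom l l≢ = subst (λ x → q ≤ x + above w j l) (stepF-other (suc m) f l l≢) (dom l)
  fwd : Dominates q (stepF (suc m) f) (above w j) → Dominates q f (above w′ j)
  fwd dom l with l ≟ suc m
  ... | no l≢ = subst (λ x → q ≤ f l + x) (sym (above-demazureStep w m j l l≢)) (off dom l l≢)
  ... | yes refl with above-at-step w m j
  ...   | inj₁ le = begin
    q                                    ≤⟨ off dom m (<⇒≢ (n<1+n m)) ⟩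
    f m + above w j m                    ≤⟨ +-monoˡ-≤ _ (proj₂ (h m)) ⟩
    suc (f (suc m)) + above w j m        ≡⟨ +-suc _ _ ⟨
    f (suc m) + suc (above w j m)        ≤⟨ +-monoʳ-≤ (f (suc m)) le ⟩
    f (suc m) + above w′ j (suc m)       ∎
    where open ≤-Reasoning
  ...   | inj₂ le = begin
    q                                               ≤⟨ off dom (suc (suc m)) 1+n≢n ⟩
    f (suc (suc m)) + above w j (suc (suc m))       ≤⟨ +-mono-≤ (proj₁ (h (suc m))) le ⟩
    f (suc m) + above w′ j (suc m)                  ∎
    where open ≤-Reasoning
  off′ : Dominates q f (above w′ j) → ∀ l → l ≢ suc m → q ≤ f l + above w j l
  off′ dom l l≢ = subst (λ x → q ≤ f l + x) (above-demazureStep w m j l l≢) (dom l)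
  bwd : Dominates q f (above w′ j) → Dominates q (stepF (suc m) f) (above w j)
  bwd dom l with l ≟ suc m
  ... | no l≢ = subst (λ x → q ≤ x + above w j l) (sym (stepF-other (suc m) f l l≢)) (off′ dom l l≢)
  ... | yes refl rewrite stepF-here (suc m) f with ⊓-sel (f m) (suc (f (suc (suc m))))
  ...   | inj₁ eq rewrite eq = ≤-trans (off′ dom m (<⇒≢ (n<1+n m))) (+-monoʳ-≤ (f m) (above-≤-suc w j m))
  ...   | inj₂ eq rewrite eq = begin
    q                                                ≤⟨ off′ dom (suc (suc m)) 1+n≢n ⟩
    f (suc (suc m)) + above w j (suc (suc m))        ≤⟨ +-monoʳ-≤ (f (suc (suc m))) (above-suc-≤ w j (suc m)) ⟩
    f (suc (suc m)) + suc (above w j (suc m))        ≡⟨ +-suc _ _ ⟩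
    suc (f (suc (suc m))) + above w j (suc m)        ∎
    where open ≤-Reasoning

-- The first letter is outermost in `foldr` and is applied first in `foldl`, so each use of the
-- adjunction moves it across. On f the word therefore acts from its last letter on.
word-adjoint : ∀ q f W w j → All (1 ≤_) W → Descends f →
  Dominates q (foldr stepF f W) (above w j) ⇔ Dominates q f (above (foldl demazureStep w W) j)
word-adjoint q f []          w j []        h = ⇔-refl
word-adjoint q f (suc m ∷ W) w j (_ ∷ 1≤W) h = ⇔-trans
  (step-adjoint q (foldr stepF f W) w m j (foldr-stepF-descends W f 1≤W h))
  (word-adjoint q f W (demazureStep w (suc m)) j 1≤W h)

descends-∸ : ∀ d → Descends (d ∸_)
descends-∸ d l rewrite sym (pred[m∸n]≡m∸[1+n] d l) = pred[n]≤n , suc-pred-≤ (d ∸ l)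
  where
  suc-pred-≤ : ∀ x → x ≤ suc (pred x)
  suc-pred-≤ zero    = z≤n
  suc-pred-≤ (suc x) = ≤-refl

descends-≤-+ : ∀ {f} → Descends f → ∀ l j → f j ≤ f l + (l ∸ j)
descends-≤-+ {f} h l j with ≤-total l j
... | inj₁ l≤j = ≤-trans (subst (λ x → f x ≤ f l) (m∸n+n≡m l≤j) (anti (j ∸ l))) (m≤m+n _ _)
  where
  anti : ∀ e → f (e + l) ≤ f l
  anti zero    = ≤-refl
  anti (suc e) = ≤-trans (proj₁ (h (e + l))) (anti e)
... | inj₂ j≤l = subst (λ x → f j ≤ f x + (l ∸ j)) (m∸n+n≡m j≤l) (lip (l ∸ j))
  where
  lip : ∀ e → f j ≤ f (e + j) + e
  lip zero    = m≤m+n _ _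
  lip (suc e) = begin
    f j                          ≤⟨ lip e ⟩
    f (e + j) + e                ≤⟨ +-monoˡ-≤ e (proj₂ (h (e + j))) ⟩
    suc (f (suc e + j)) + e      ≡⟨ +-suc _ e ⟨
    f (suc e + j) + suc e        ∎
    where open ≤-Reasoning

-- `d ∸_` counts the particles 1,...,d, and `above id j l` is l ∸ j. Both are extremal in such a way
-- that the pairing collapses to a single l: to l = d on the side of the product and to l = j on the
-- side of the particles, since counts are monotone and change by at most one per step.
above-demazure : ∀ W d j q → All (1 ≤_) W →
  q ≤ above (foldl demazureStep id W) j d ⇔ q ≤ foldr stepF (d ∸_) W j
above-demazure W d j q 1≤W = mk⇔
  (λ q≤ → ≤-trans (from adj (λ l → ≤-trans q≤ (above-≤-+ _ j d l)) j)
     (≤-reflexive (trans (cong (F j +_) (trans (above-id j j) (n∸n≡0 j))) (+-identityʳ _))))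
  (λ q≤ → ≤-trans (to adj (λ l → ≤-trans q≤ (≤-trans (descends-≤-+ F↓ l j)
       (≤-reflexive (cong (F l +_) (sym (above-id j l)))))) d)
     (≤-reflexive (cong (_+ above (foldl demazureStep id W) j d) (n∸n≡0 d))))
  where
  F = foldr stepF (d ∸_) W
  F↓ = foldr-stepF-descends W (d ∸_) 1≤W (descends-∸ d)
  adj = word-adjoint q (d ∸_) W id j 1≤W (descends-∸ d)

-- The square word and masks as predicates on cells

Cell : Set
Cell = ℕ × ℕ

letter : Cell → ℕ
letter c = (proj₁ c + proj₂ c) ∸ 1

-- Here p selects the subword P, whose complement is the face.
faceOf : ℕ → (Cell → Bool) → Mask
faceOf n p = map (not ∘ p) (cellsQ n)

∈-[1…]⁺ : ∀ {x n} → 1 ≤ x → x ≤ n → x ∈ [1…] n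
∈-[1…]⁺ {suc x} _ x<n = ∈-map⁺ suc (∈-upTo⁺ x<n)

∈-[1…]⁻ : ∀ {x n} → x ∈ [1…] n → 1 ≤ x × x ≤ n
∈-[1…]⁻ x∈ with ∈-map⁻ suc x∈
... | y , y∈ , refl = s≤s z≤n , ∈-upTo⁻ y∈

[1…]-unique : ∀ n → Unique ([1…] n)
[1…]-unique n = Uniqueₚ.map⁺ suc-injective (Uniqueₚ.upTo⁺ n)

length-[1…] : ∀ n → length ([1…] n) ≡ n
length-[1…] n = trans (length-map suc (upTo n)) (length-upTo n)

reverse-[1…]-suc : ∀ n → reverse ([1…] (suc n)) ≡ suc n ∷ reverse ([1…] n)
reverse-[1…]-suc n = trans (cong reverse ([1…]-suc n)) (reverse-++ ([1…] n) _)

rowCells : ℕ → ℕ → List Cell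
rowCells n i = map (λ j → (i , j)) (reverse ([1…] n))

∈-cellsQ⁺ : ∀ {n i j} → 1 ≤ i → i ≤ n → 1 ≤ j → j ≤ n → (i , j) ∈ cellsQ n
∈-cellsQ⁺ {n} {i} {j} 1≤i i≤n 1≤j j≤n = ∈-concatMap⁺ (rowCells n)
  (lose (∈-[1…]⁺ 1≤i i≤n) (∈-map⁺ (i ,_) (Anyₚ.reverse⁺ (∈-[1…]⁺ 1≤j j≤n))))

∈-cellsQ⁻ : ∀ {n i j} → (i , j) ∈ cellsQ n → (1 ≤ i × i ≤ n) × (1 ≤ j × j ≤ n)
∈-cellsQ⁻ {n} c∈ with find (∈-concatMap⁻ (rowCells n) {xs = [1…] n} c∈)
... | i , i∈ , c∈row with ∈-map⁻ (i ,_) c∈row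
...   | j , j∈ , refl = ∈-[1…]⁻ i∈ , ∈-[1…]⁻ (Anyₚ.reverse⁻ j∈)

cellsQ-unique : ∀ n → Unique (cellsQ n)
cellsQ-unique n = go ([1…]-unique n)
  where
  rev : Unique (reverse ([1…] n))
  rev = subst Unique (sym (trans (cong reverse (map-upTo suc n)) (reverse-applyUpTo suc n)))
          (Uniqueₚ.applyDownFrom⁺₁ suc n λ j<i i<n eq → <⇒≢ j<i (sym (suc-injective eq)))
  go : ∀ {is} → Unique is → Unique (concatMap (rowCells n) is)
  go []                     = []
  go {i ∷ is} (i∉ ∷ is-u) = Uniqueₚ.++⁺ (Uniqueₚ.map⁺ (proj₂ ∘ ,-injective) rev) (go is-u) disjoint
    where
    disjoint : ∀ {c} → ¬ (c ∈ rowCells n i × c ∈ concatMap (rowCells n) is)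
    disjoint (c∈i , c∈is) with ∈-map⁻ (i ,_) c∈i
    ... | j , _ , refl with find (∈-concatMap⁻ (rowCells n) {xs = is} c∈is)
    ...   | i′ , i′∈ , c∈i′ with ∈-map⁻ (i′ ,_) c∈i′
    ...     | _ , _ , eq = All.lookup i∉ i′∈ (proj₁ (,-injective eq))

length-cellsQ : ∀ n → length (cellsQ n) ≡ n * n
length-cellsQ n = trans (go ([1…] n)) (cong (_* n) (length-[1…] n))
  where
  go : ∀ is → length (concatMap (rowCells n) is) ≡ length is * n
  go []       = refl
  go (i ∷ is) = trans (length-++ (rowCells n i)) (cong₂ _+_
    (trans (length-map (i ,_) (reverse ([1…] n))) (trans (length-reverse ([1…] n)) (length-[1…] n))) (go is))

length-faceOf : ∀ n p → length (faceOf n p) ≡ n * n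
length-faceOf n p = trans (length-map _ (cellsQ n)) (length-cellsQ n)

-- The predicate is built by overriding its value at one cell at a time; distinctness of the cells
-- keeps the tail unaffected.
mask→predicate : ∀ {xs : List Cell} {F : Mask} → Unique xs → length F ≡ length xs →
  ∃ λ p → map (not ∘ p) xs ≡ F
mask→predicate {[]}     {[]}    _          _  = (λ _ → false) , refl
mask→predicate {x ∷ xs} {b ∷ F} (x∉ ∷ u) eq with mask→predicate {xs} {F} u (suc-injective eq)
... | p , refl = p′ , cong₂ _∷_ at-x (map-cong-local (All.map off-x x∉))
  where
  _≟ᶜ_ : (c c′ : Cell) → Dec (c ≡ c′)
  _≟ᶜ_ = ≡-dec _≟_ _≟_
  p′ : Cell → Bool
  p′ c with x ≟ᶜ c
  ... | yes _ = not b
  ... | no  _ = p c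
  at-x : not (p′ x) ≡ b
  at-x with x ≟ᶜ x
  ... | yes _  = not-involutive b
  ... | no x≢x = contradiction refl x≢x
  off-x : ∀ {y} → x ≢ y → not (p′ y) ≡ not (p y)
  off-x {y} x≢y with x ≟ᶜ y
  ... | yes x≡y = contradiction x≡y x≢y
  ... | no _    = refl

filter-zip : ∀ {A : Set} (p : A → Bool) xs → map proj₁ (filterᵇ proj₂ (zip xs (map p xs))) ≡ filterᵇ p xs
filter-zip p []       = refl
filter-zip p (x ∷ xs) with p x
... | true  = cong (x ∷_) (filter-zip p xs)
... | false = filter-zip p xs

complement-faceOf : ∀ n p → complement (faceOf n p) ≡ map p (cellsQ n)
complement-faceOf n p = trans (sym (map-∘ (cellsQ n))) (map-cong (λ c → not-involutive (p c)) (cellsQ n))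

selected-complement : ∀ n p → selected n (complement (faceOf n p)) ≡ filterᵇ p (cellsQ n)
selected-complement n p = trans (cong (selected n) (complement-faceOf n p)) (filter-zip p (cellsQ n))

word : ℕ → (Cell → Bool) → List ℕ
word n p = map letter (filterᵇ p (cellsQ n))

demazure-faceOf : ∀ n p → demazure n (complement (faceOf n p)) ≡ foldl demazureStep id (word n p)
demazure-faceOf n p = cong (foldl demazureStep id ∘ map letter) (selected-complement n p)

1≤letter : ∀ {n i j} → (i , j) ∈ cellsQ n → 1 ≤ letter (i , j)
1≤letter {n} {suc i} {suc j} _ = ≤-trans (s≤s z≤n) (m≤n+m (suc j) i)
1≤letter {n} {zero} {j} c∈ with ∈-cellsQ⁻ {n} c∈
... | (() , _) , _
1≤letter {n} {suc i} {zero} c∈ with ∈-cellsQ⁻ {n} c∈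
... | _ , (() , _)

1≤word : ∀ n p → All (1 ≤_) (word n p)
1≤word n p = Allₚ.map⁺ (All.tabulate λ c∈ → 1≤letter {n} (proj₁ (∈-filter⁻ (T? ∘ p) {xs = cellsQ n} c∈)))

stepCell : (Cell → Bool) → Cell → (ℕ → ℕ) → (ℕ → ℕ)
stepCell p c f = if p c then stepF (letter c) f else f

stepRow : (Cell → Bool) → ℕ → ℕ → (ℕ → ℕ) → (ℕ → ℕ)
stepRow p n i f = foldr (stepCell p) f (rowCells n i)

foldr-word : ∀ p f cs → foldr stepF f (map letter (filterᵇ p cs)) ≡ foldr (stepCell p) f cs
foldr-word p f []       = refl
foldr-word p f (c ∷ cs) with p c
... | true  = cong (stepF (letter c)) (foldr-word p f cs)
... | false = foldr-word p f cs

foldr-cellsQ : ∀ p n f is → foldr (stepCell p) f (concatMap (rowCells n) is) ≡ foldr (stepRow p n) f is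
foldr-cellsQ p n f []       = refl
foldr-cellsQ p n f (i ∷ is) = trans (foldr-++ (stepCell p) f (rowCells n i) _) (cong (stepRow p n i) (foldr-cellsQ p n f is))

stepRow-suc : ∀ p n i f → stepRow p (suc n) i f ≡ stepCell p (i , suc n) (stepRow p n i f)
stepRow-suc p n i f = cong (foldr (stepCell p) f ∘ map (i ,_)) (reverse-[1…]-suc n)

foldr-[1…]-suc : ∀ {A : Set} (g : ℕ → A → A) x n → foldr g x ([1…] (suc n)) ≡ foldr g (g (suc n) x) ([1…] n)
foldr-[1…]-suc g x n = trans (cong (foldr g x) ([1…]-suc n)) (foldr-∷ʳ g x (suc n) ([1…] n))

-- The greedy filling

best : (ℕ → Bool) → ℕ → ℕ
best q zero    = zero
best q (suc N) = if q (suc N) then suc N else best q N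

best-≤ : ∀ q N → best q N ≤ N
best-≤ q zero    = z≤n
best-≤ q (suc N) with q (suc N)
... | true  = ≤-refl
... | false = m≤n⇒m≤1+n (best-≤ q N)

best-sat : ∀ q N → 1 ≤ best q N → T (q (best q N))
best-sat q (suc N) 1≤ with q (suc N) in eq
... | true  = from T-≡ eq
... | false = best-sat q N 1≤

best-max : ∀ q N t → 1 ≤ t → t ≤ N → T (q t) → t ≤ best q N
best-max q zero    t       1≤t t≤N qt = contradiction (≤-trans 1≤t t≤N) λ ()
best-max q (suc N) t       1≤t t≤N qt with q (suc N) in eq
... | true  = t≤N
... | false with m≤n⇒m<n∨m≡n t≤N
...   | inj₁ t<1+N = best-max q N t 1≤t (s≤s⁻¹ t<1+N) qt
...   | inj₂ refl  = contradiction (to T-≡ qt) λ eq′ → contradiction (trans (sym eq) eq′) λ ()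

-- Row a of the shape is indexed by k = d - a, so k = 0 is the bottom row; greedy k b is 0
-- when no entry is possible, and suc d in the virtual column b = 0.
module Greedy (n d : ℕ) (p : Cell → Bool) where

  -- An entry t on antidiagonal s uses the cell (t, s - t). The first comparison makes the
  -- subtraction exact and the column positive, the second keeps the column within the grid.
  allowed : ℕ → ℕ → Bool
  allowed t s = (t <ᵇ s) ∧ ((s ≤ᵇ t + n) ∧ p (t , s ∸ t))

  allowed-+ : ∀ t c → c < n → allowed t (t + suc c) ≡ p (t , suc c)
  allowed-+ t c c<n = begin
    allowed t (t + suc c)            ≡⟨ cong₂ (λ x y → x ∧ (y ∧ p (t , t + suc c ∸ t)))
                                          (<ᵇ-true (m<m+n t (s≤s z≤n))) (≤ᵇ-true (+-monoʳ-≤ t c<n)) ⟩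
    p (t , t + suc c ∸ t)            ≡⟨ cong (λ x → p (t , x)) (m+n∸m≡n t (suc c)) ⟩
    p (t , suc c)                    ∎
    where open ≡-Reasoning

  greedy : ℕ → ℕ → ℕ
  greedy k       zero    = suc d
  greedy zero    (suc b) = best (λ t → allowed t (d + suc b)) (greedy zero b ⊓ d)
  greedy (suc k) (suc b) = best (λ t → allowed t (d + suc b ∸ suc k)) (greedy (suc k) b ⊓ pred (greedy k (suc b)))

  bound : ℕ → ℕ → ℕ
  bound zero    b = d
  bound (suc k) b = pred (greedy k b)

  greedy-suc : ∀ k b → greedy k (suc b) ≡ best (λ t → allowed t (d + suc b ∸ k)) (greedy k b ⊓ bound k (suc b))
  greedy-suc zero    b = refl
  greedy-suc (suc k) b = refl

  greedy-≤-left : ∀ k b → greedy k (suc b) ≤ greedy k b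
  greedy-≤-left k b rewrite greedy-suc k b = ≤-trans (best-≤ _ (greedy k b ⊓ bound k (suc b))) (m⊓n≤m (greedy k b) _)

  greedy-≤-bound : ∀ k b → greedy k (suc b) ≤ bound k (suc b)
  greedy-≤-bound k b rewrite greedy-suc k b = ≤-trans (best-≤ _ (greedy k b ⊓ bound k (suc b))) (m⊓n≤n (greedy k b) _)

  greedy-allowed : ∀ k b → 1 ≤ greedy k (suc b) → T (allowed (greedy k (suc b)) (d + suc b ∸ k))
  greedy-allowed k b 1≤ rewrite greedy-suc k b = best-sat _ (greedy k b ⊓ bound k (suc b)) 1≤

  greedy-max : ∀ k b t → 1 ≤ t → T (allowed t (d + suc b ∸ k)) → t ≤ greedy k b → t ≤ bound k (suc b) →
    t ≤ greedy k (suc b)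
  greedy-max k b t 1≤t ok t≤l t≤b rewrite greedy-suc k b =
    best-max _ (greedy k b ⊓ bound k (suc b)) t 1≤t (⊓-glb t≤l t≤b) ok

  greedy-≤ : ∀ k b → greedy k (suc b) ≤ d
  greedy-≤ zero    b = greedy-≤-bound zero b
  greedy-≤ (suc k) b = ≤-trans (greedy-≤-bound (suc k) b) (≤-trans pred[n]≤n (greedy-≤ k b))

  greedy-antitone : ∀ k {b c} → b ≤ c → greedy k c ≤ greedy k b
  greedy-antitone k {b} {c} b≤c = subst (λ x → greedy k x ≤ greedy k b) (m∸n+n≡m b≤c) (go (c ∸ b))
    where
    go : ∀ e → greedy k (e + b) ≤ greedy k b
    go zero    = ≤-refl
    go (suc e) = ≤-trans (greedy-≤-left k (e + b)) (go e)

  Low : (ℕ → ℕ) → Set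
  Low f = ∀ l → d ∸ l ≤ f l

  -- f describes the state of the greedy filling after the rows t + 1, t + 2, … and the
  -- first c cells of row t have been processed.
  record Inv (t c : ℕ) (f : ℕ → ℕ) : Set where
    field
      low   : Low f
      done  : ∀ k b j → suc j + k ≡ d + b → j < t + c → suc k ≤ f j ⇔ t ≤ greedy k b
      todo  : ∀ k b j → suc j + k ≡ d + b → t + c ≤ j → suc k ≤ f j ⇔ suc t ≤ greedy k b
  open Inv

  antidiagonal : ∀ {k b j} → suc j + k ≡ d + b → d + b ∸ k ≡ suc j
  antidiagonal {k} {b} {j} eq = trans (cong (_∸ k) (sym eq)) (m+n∸n≡m (suc j) k)

  -- Every positive greedy entry is allowed, so it cannot equal a t that is not allowed on its
  -- antidiagonal. The virtual column holds suc d, which exceeds t.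
  skip : ∀ {t} k b j → suc j + k ≡ d + b → 1 ≤ t → t ≤ d → ¬ T (allowed t (suc j)) →
    suc t ≤ greedy k b ⇔ t ≤ greedy k b
  skip k zero    j eq 1≤t t≤d no! = mk⇔ (λ _ → m≤n⇒m≤1+n t≤d) (λ _ → s≤s t≤d)
  skip k (suc b) j eq 1≤t t≤d no! = mk⇔ (≤-trans (n≤1+n _)) λ t≤ → ≤∧≢⇒< t≤ λ { refl →
    no! (subst (λ s → T (allowed (greedy k (suc b)) s)) (antidiagonal eq) (greedy-allowed k b 1≤t)) }

  -- Particles only move to the right, so never fewer of them lie beyond l than in the initial set
  -- {1,...,d}.
  low-stepF : ∀ m f → Low f → Low (stepF (suc m) f)
  low-stepF m f lo l with l ≟ suc m
  ... | no l≢ rewrite stepF-other (suc m) f l l≢ = lo l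
  ... | yes refl rewrite stepF-here (suc m) f = ⊓-glb
    (≤-trans (∸-monoʳ-≤ d (n≤1+n m)) (lo m))
    (≤-trans (proj₂ (descends-∸ d (suc m))) (s≤s (lo (suc (suc m)))))

  -- Only the count at the letter changes, to the minimum of f m and suc (f (m + 2)). The first term
  -- is a threshold already treated in row t and says that the left neighbour is at least t. The
  -- second concerns the particle in front, not yet treated in row t, and says that the entry below
  -- is at least t + 1. With `allowed` these are the conditions defining the greedy entry.
  stepCell-Inv : ∀ t c f → 1 ≤ t → t ≤ d → c < n → Inv t c f → Inv t (suc c) (stepCell p (t , suc c) f)
  stepCell-Inv (suc t₀) c f 1≤t t≤d c<n inv = by-case (p (t , suc c)) refl
    where
    t = suc t₀
    m = t₀ + c
    letter≡ : letter (t , suc c) ≡ suc m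
    letter≡ = +-suc t₀ c
    t+c+1≡ : t + suc c ≡ suc (suc m)
    t+c+1≡ = +-suc t c
    allowed≡p : allowed t (suc (suc m)) ≡ p (t , suc c)
    allowed≡p = subst (λ s → allowed t s ≡ p (t , suc c)) t+c+1≡ (allowed-+ t c c<n)
    module _ (f′ : ℕ → ℕ) (other : ∀ l → l ≢ suc m → f′ l ≡ f l) (low′ : Low f′)
             (new : ∀ k b → suc (suc m) + k ≡ d + b → suc k ≤ f′ (suc m) ⇔ t ≤ greedy k b) where
      result : Inv t (suc c) f′
      result .low = low′
      result .done k b j eq j< with j ≟ suc m
      ... | yes refl = new k b eq
      ... | no j≢ rewrite other j j≢ =
        inv .done k b j eq (≤∧≢⇒< (s≤s⁻¹ (subst (j <_) t+c+1≡ j<)) j≢)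
      result .todo k b j eq ≤j rewrite other j (>⇒≢ (subst (_≤ j) t+c+1≡ ≤j)) =
        inv .todo k b j eq (≤-trans (n≤1+n _) (subst (_≤ j) t+c+1≡ ≤j))
    by-case : ∀ x → p (t , suc c) ≡ x → Inv t (suc c) (if x then stepF (letter (t , suc c)) f else f)
    by-case false p≡ = result f (λ _ _ → refl) (inv .low) λ k b eq →
      ⇔-trans (inv .todo k b (suc m) eq ≤-refl)
        (skip k b (suc m) eq 1≤t t≤d (λ ok → subst T (trans allowed≡p p≡) ok))
    by-case true p≡ rewrite letter≡ = result (stepF (suc m) f) (stepF-other (suc m) f) low′ new
      where
      low′ = low-stepF m f (inv .low)
      ok : T (allowed t (suc (suc m)))
      ok = from T-≡ (trans allowed≡p p≡)
      below : ∀ k b → suc (suc m) + k ≡ d + suc b → suc k ≤ suc (f (suc (suc m))) ⇔ t ≤ bound k (suc b)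
      below zero    b eq = mk⇔ (λ _ → t≤d) (λ _ → s≤s z≤n)
      below (suc k) b eq = ⇔-trans (mk⇔ s≤s⁻¹ s≤s) (⇔-trans
        (inv .todo k (suc b) (suc (suc m)) (trans (cong (suc ∘ suc) (sym (+-suc m k))) eq) (n≤1+n _))
        (mk⇔ pred-mono-≤ (λ t≤ → suc-≤-of-pred (greedy k (suc b)) t≤)))
        where
        suc-≤-of-pred : ∀ x → t ≤ pred x → suc t ≤ x
        suc-≤-of-pred (suc x) t≤x = s≤s t≤x
      new : ∀ k b → suc (suc m) + k ≡ d + b → suc k ≤ stepF (suc m) f (suc m) ⇔ t ≤ greedy k b
      -- In column 0 both sides hold: the particle starts beyond the letter, and `Low` says that it
      -- never moves back.
      new k zero eq = mk⇔ (λ _ → m≤n⇒m≤1+n t≤d)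
        (λ _ → ≤-trans (≤-reflexive (sym d∸m≡)) (low′ (suc m)))
        where
        d∸m≡ : d ∸ suc m ≡ suc k
        d∸m≡ = trans (cong (_∸ suc m) (trans (sym (+-identityʳ d)) (trans (sym eq) (sym (+-suc (suc m) k)))))
          (m+n∸m≡n (suc m) (suc k))
      new k (suc b) eq rewrite stepF-here (suc m) f = mk⇔
        (λ k< → greedy-max k b t 1≤t (subst (T ∘ allowed t) (sym (antidiagonal {k} {suc b} eq)) ok)
          (to left (≤-trans k< (m⊓n≤m (f m) _))) (to (below k b eq) (≤-trans k< (m⊓n≤n (f m) _))))
        (λ t≤ → ⊓-glb (from left (≤-trans t≤ (greedy-≤-left k b))) (from (below k b eq) (≤-trans t≤ (greedy-≤-bound k b))))
        where
        left : suc k ≤ f m ⇔ t ≤ greedy k b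
        left = inv .done k b m (suc-injective (trans eq (+-suc d b))) ≤-refl

  stepRow-Inv : ∀ t c f → 1 ≤ t → t ≤ d → c ≤ n → Inv t 0 f → Inv t c (stepRow p c t f)
  stepRow-Inv t zero    f 1≤t t≤d c≤n inv = inv
  stepRow-Inv t (suc c) f 1≤t t≤d c<n inv = subst (Inv t (suc c)) (sym (stepRow-suc p c t f))
    (stepCell-Inv t c _ 1≤t t≤d c<n (stepRow-Inv t c f 1≤t t≤d (<⇒≤ c<n) inv))

  record RowInv (t : ℕ) (f : ℕ → ℕ) : Set where
    field
      rlow : Low f
      rinv : ∀ k b j → suc j + k ≡ d + b → suc k ≤ f j ⇔ t ≤ greedy k b
  open RowInv

  -- The letters of row t are t,...,t + n - 1. A threshold at j outside this range belongs to an
  -- antidiagonal without a cell in row t, so `skip` settles it: for j < t before the row is read,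
  -- for j ≥ t + n afterwards.
  stepRow-RowInv : ∀ t f → 1 ≤ t → t ≤ d → RowInv (suc t) f → RowInv t (stepRow p n t f)
  stepRow-RowInv t f 1≤t t≤d inv = record { rlow = end .low ; rinv = rinv′ }
    where
    begin′ : Inv t 0 f
    begin′ .low = inv .rlow
    begin′ .todo k b j eq _ = inv .rinv k b j eq
    begin′ .done k b j eq j< = ⇔-trans (inv .rinv k b j eq) (skip k b j eq 1≤t t≤d no!)
      where
      no! : ¬ T (allowed t (suc j))
      no! ok rewrite <ᵇ-false (subst (suc j ≤_) (+-identityʳ t) j<) = ok
    end = stepRow-Inv t n f 1≤t t≤d ≤-refl begin′
    rinv′ : ∀ k b j → suc j + k ≡ d + b → suc k ≤ stepRow p n t f j ⇔ t ≤ greedy k b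
    rinv′ k b j eq with j <? t + n
    ... | yes j< = end .done k b j eq j<
    ... | no  j≮ = ⇔-trans (end .todo k b j eq (≮⇒≥ j≮)) (skip k b j eq 1≤t t≤d no!)
      where
      no! : ¬ T (allowed t (suc j))
      no! ok rewrite ≤ᵇ-false (s≤s (≮⇒≥ j≮)) | ∧-zeroʳ (t <ᵇ suc j) = ok

  rows-RowInv : ∀ t f → t ≤ d → RowInv (suc t) f → RowInv 1 (foldr (stepRow p n) f ([1…] t))
  rows-RowInv zero    f t≤d inv = inv
  rows-RowInv (suc t) f t≤d inv = subst (RowInv 1) (sym (foldr-[1…]-suc (stepRow p n) f t))
    (rows-RowInv t _ (<⇒≤ t≤d) (stepRow-RowInv (suc t) f (s≤s z≤n) t≤d inv))

  -- Rows below row d do not act on the set {1,…,d}.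
  Initial : (ℕ → ℕ) → Set
  Initial f = ∀ l → f l ≡ d ∸ l

  stepRow-Initial : ∀ t c f → d < t → Initial f → Initial (stepRow p c t f)
  stepRow-Initial t zero    f d<t h l = h l
  stepRow-Initial t (suc c) f d<t h l rewrite stepRow-suc p c t f with p (t , suc c)
  ... | false = stepRow-Initial t c f d<t h l
  ... | true  with l ≟ letter (t , suc c)
  ...   | no l≢ = trans (stepF-other _ g l l≢) (stepRow-Initial t c f d<t h l)
    where g = stepRow p c t f
  ...   | yes refl = begin
      stepF l g l                    ≡⟨ stepF-here l g ⟩
      g (pred l) ⊓ suc (g (suc l))   ≡⟨ cong (_⊓ suc (g (suc l))) (trans (stepRow-Initial t c f d<t h (pred l)) (m≤n⇒m∸n≡0 d≤l-1)) ⟩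
      0                              ≡⟨ m≤n⇒m∸n≡0 {d} {l} (≤-trans d≤l-1 pred[n]≤n) ⟨
      d ∸ l                          ∎
    where
    open ≡-Reasoning
    g = stepRow p c t f
    d≤l-1 : d ≤ pred (letter (t , suc c))
    d≤l-1 rewrite +-suc t c = pred-mono-≤ (≤-trans d<t (m≤m+n t c))

  Initial-RowInv : ∀ f → Initial f → RowInv (suc d) f
  Initial-RowInv f h .rlow l = ≤-reflexive (sym (h l))
  Initial-RowInv f h .rinv k zero j eq = mk⇔ (λ _ → ≤-refl) λ _ → ≤-reflexive (sym (trans (h j) (begin
    d ∸ j            ≡⟨ cong (_∸ j) (trans (sym (+-identityʳ d)) (trans (sym eq) (sym (+-suc j k)))) ⟩
    (j + suc k) ∸ j  ≡⟨ m+n∸m≡n j (suc k) ⟩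
    suc k            ∎)))
    where open ≡-Reasoning
  Initial-RowInv f h .rinv k (suc b) j eq = mk⇔
    (λ k< → contradiction (subst (suc k ≤_) (h j) k<) (<⇒≱ d∸j≤k))
    (λ d< → contradiction (greedy-≤ k b) (<⇒≱ d<))
    where
    d∸j≤k : d ∸ j < suc k
    d∸j≤k = s≤s (m≤n+o⇒m∸n≤o d j (≤-trans (m≤m+n d b) (≤-reflexive (sym (suc-injective (trans eq (+-suc d b)))))))

  all-rows : ∀ e f → Initial f → RowInv 1 (foldr (stepRow p n) f ([1…] (e + d)))
  all-rows zero    f h = rows-RowInv d f ≤-refl (Initial-RowInv f h)
  all-rows (suc e) f h = subst (RowInv 1) (sym (foldr-[1…]-suc (stepRow p n) f (e + d)))
    (all-rows e _ (stepRow-Initial (suc (e + d)) n f (s≤s (m≤n+m d e)) h))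

  -- At the final threshold t = 1, `1 ≤ greedy k b` says that the b-th jump takes place at all. The
  -- hypothesis d ≤ n splits the rows into n - d inert ones and the first d.
  above-greedy : d ≤ n → ∀ k b j → suc j + k ≡ d + b →
    suc k ≤ above (demazure n (complement (faceOf n p))) j d ⇔ 1 ≤ greedy k b
  above-greedy d≤n k b j eq rewrite demazure-faceOf n p =
    ⇔-trans (above-demazure (word n p) d j (suc k) (1≤word n p))
      (subst (λ g → suc k ≤ g j ⇔ 1 ≤ greedy k b) (sym fold≡) (inv .rinv k b j eq))
    where
    inv : RowInv 1 (foldr (stepRow p n) (d ∸_) ([1…] n))
    inv = subst (λ x → RowInv 1 (foldr (stepRow p n) (d ∸_) ([1…] x))) (m∸n+n≡m d≤n) (all-rows (n ∸ d) _ λ _ → refl)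
    fold≡ : foldr stepF (d ∸_) (word n p) ≡ foldr (stepRow p n) (d ∸_) ([1…] n)
    fold≡ = trans (foldr-word p _ (cellsQ n)) (foldr-cellsQ p n _ ([1…] n))

-- This stands in for injectivity of the Demazure product: particles started at 1,...,i never move
-- left, so at least i - j of the first i values exceed j.
cornerPerm-demazure-≤ : ∀ n p i j → cornerPerm (demazure n (complement (faceOf n p))) i j ≤ j
cornerPerm-demazure-≤ n p i j = +-cancelʳ-≤ (above δ j i) _ _ (begin
  cornerPerm δ i j + above δ j i  ≡⟨ cornerPerm+above δ i j ⟩
  i                               ≤⟨ m≤n+m∸n i j ⟩
  j + (i ∸ j)                     ≤⟨ +-monoʳ-≤ j i∸j≤ ⟩
  j + above δ j i                 ∎)
  where
  open ≤-Reasoning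
  δ = demazure n (complement (faceOf n p))
  low-fold : ∀ W → All (1 ≤_) W → ∀ l → i ∸ l ≤ foldr stepF (i ∸_) W l
  low-fold []          _          l = ≤-refl
  low-fold (suc m ∷ W) (_ ∷ 1≤W) = Greedy.low-stepF n i p m _ (low-fold W 1≤W)
  i∸j≤ : i ∸ j ≤ above δ j i
  i∸j≤ rewrite demazure-faceOf n p = from (above-demazure (word n p) i j (i ∸ j) (1≤word n p)) (low-fold (word n p) (1≤word n p) j)

-- Grassmannian permutations

cornerPerm-suc : ∀ w i j → cornerPerm w (suc i) j ≡ cornerPerm w i j + bit (w (suc i) ≤ᵇ j)
cornerPerm-suc w i j = countᵇ-[1…]-suc (λ k → w k ≤ᵇ j) i

cornerPerm-≤ : ∀ w i j → cornerPerm w i j ≤ i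
cornerPerm-≤ w i j = ≤-trans (m≤m+n _ _) (≤-reflexive (cornerPerm+above w i j))

cornerPerm-mono-suc : ∀ w i j → cornerPerm w i j ≤ cornerPerm w (suc i) j
cornerPerm-mono-suc w i j = ≤-trans (m≤m+n _ _) (≤-reflexive (sym (cornerPerm-suc w i j)))

cornerPerm-mono-+ : ∀ w e i j → cornerPerm w i j ≤ cornerPerm w (e + i) j
cornerPerm-mono-+ w zero    i j = ≤-refl
cornerPerm-mono-+ w (suc e) i j = ≤-trans (cornerPerm-mono-+ w e i j) (cornerPerm-mono-suc w (e + i) j)

cornerPerm-monoˡ : ∀ w {i i′} j → i ≤ i′ → cornerPerm w i j ≤ cornerPerm w i′ j
cornerPerm-monoˡ w {i} {i′} j i≤ = subst (λ x → cornerPerm w i j ≤ cornerPerm w x j) (m∸n+n≡m i≤) (cornerPerm-mono-+ w (i′ ∸ i) i j)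

cornerPerm-+-≤ : ∀ w e i j → cornerPerm w (e + i) j ≤ cornerPerm w i j + e
cornerPerm-+-≤ w zero    i j = m≤m+n _ _
cornerPerm-+-≤ w (suc e) i j = begin
  cornerPerm w (suc e + i) j                              ≡⟨ cornerPerm-suc w (e + i) j ⟩
  cornerPerm w (e + i) j + bit (w (suc e + i) ≤ᵇ j)       ≤⟨ +-mono-≤ (cornerPerm-+-≤ w e i j) (bit-≤ (w (suc e + i) ≤ᵇ j)) ⟩
  cornerPerm w i j + e + 1                                ≡⟨ trans (+-assoc _ e 1) (cong (cornerPerm w i j +_) (+-comm e 1)) ⟩
  cornerPerm w i j + suc e                                ∎
  where
  open ≤-Reasoning
  bit-≤ : ∀ b → bit b ≤ 1
  bit-≤ true  = ≤-refl
  bit-≤ false = z≤n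

cornerPerm-monoʳ : ∀ w i {j j′} → j ≤ j′ → cornerPerm w i j ≤ cornerPerm w i j′
cornerPerm-monoʳ w zero    j≤ = z≤n
cornerPerm-monoʳ w (suc i) {j} {j′} j≤ rewrite cornerPerm-suc w i j | cornerPerm-suc w i j′ =
  +-mono-≤ (cornerPerm-monoʳ w i j≤) bit-mono
  where
  bit-mono : bit (w (suc i) ≤ᵇ j) ≤ bit (w (suc i) ≤ᵇ j′)
  bit-mono with w (suc i) ≤? j
  ... | yes le rewrite ≤ᵇ-true le | ≤ᵇ-true (≤-trans le j≤) = ≤-refl
  ... | no ¬le rewrite ≤ᵇ-false (≰⇒> ¬le) = z≤n

cornerPerm-full : ∀ w p j → (∀ k → 1 ≤ k → k ≤ p → w k ≤ j) → p ≤ cornerPerm w p j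
cornerPerm-full w zero    j h = z≤n
cornerPerm-full w (suc p) j h rewrite cornerPerm-suc w p j | ≤ᵇ-true (h (suc p) (s≤s z≤n) ≤-refl) =
  ≤-trans (s≤s (cornerPerm-full w p j λ k 1≤k k≤p → h k 1≤k (m≤n⇒m≤1+n k≤p))) (≤-reflexive (+-comm 1 _))

cornerPerm-bounded : ∀ w p i j → (∀ k → p < k → k ≤ i → j < w k) → cornerPerm w i j ≤ p
cornerPerm-bounded w p zero    j h = z≤n
cornerPerm-bounded w p (suc i) j h with p ≤? i
... | no p≰i = ≤-trans (cornerPerm-≤ w (suc i) j) (≰⇒> p≰i)
... | yes p≤i rewrite cornerPerm-suc w i j | ≤ᵇ-false (h (suc i) (s≤s p≤i) ≤-refl) =
  ≤-trans (≤-reflexive (+-identityʳ _)) (cornerPerm-bounded w p i j λ k p<k k≤i → h k p<k (m≤n⇒m≤1+n k≤i))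

nth-∈ : ∀ {A : Set} (x : A) xs p → 1 ≤ p → p ≤ length xs → nth x xs p ∈ xs
nth-∈ x (y ∷ ys) (suc zero)    _ _    = here refl
nth-∈ x (y ∷ ys) (suc (suc p)) _ p≤   = there (nth-∈ x ys (suc p) (s≤s z≤n) (s≤s⁻¹ p≤))

nth-++ : ∀ {A : Set} (x : A) xs ys p → 1 ≤ p → p ≤ length xs → nth x (xs ++ ys) p ≡ nth x xs p
nth-++ x (y ∷ xs) ys (suc zero)    _ _  = refl
nth-++ x (y ∷ xs) ys (suc (suc p)) _ p≤ = nth-++ x xs ys (suc p) (s≤s z≤n) (s≤s⁻¹ p≤)

[1…]-prefix : ∀ e j → ∃ λ ys → [1…] (e + j) ≡ [1…] j ++ ys
[1…]-prefix zero    j = [] , sym (++-identityʳ _)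
[1…]-prefix (suc e) j with [1…]-prefix e j
... | ys , eq = ys ∷ʳ suc (e + j) , trans ([1…]-suc (e + j)) (trans (cong (_∷ʳ suc (e + j)) eq) (++-assoc ([1…] j) ys _))

unique-⊆-length : ∀ {A : Set} {xs ys : List A} → Unique xs → (∀ {x} → x ∈ xs → x ∈ ys) → length xs ≤ length ys
unique-⊆-length {xs = []} _ _ = z≤n
unique-⊆-length {xs = x ∷ xs} {ys} (x∉ ∷ u) sub with ∈-∃++ (sub (here refl))
... | as , bs , refl = begin
  suc (length xs)             ≤⟨ s≤s (unique-⊆-length u sub′) ⟩
  suc (length (as ++ bs))     ≡⟨ cong suc (length-++ as) ⟩
  suc (length as + length bs) ≡⟨ +-suc (length as) (length bs) ⟨
  length as + suc (length bs) ≡⟨ length-++ as ⟨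
  length (as ++ x ∷ bs)       ∎
  where
  open ≤-Reasoning
  sub′ : ∀ {y} → y ∈ xs → y ∈ as ++ bs
  sub′ y∈ with ∈-++⁻ as (sub (there y∈))
  ... | inj₁ y∈as         = ∈-++⁺ˡ y∈as
  ... | inj₂ (here refl)  = contradiction refl (All.lookup x∉ y∈)
  ... | inj₂ (there y∈bs) = ∈-++⁺ʳ as y∈bs

countᵇ-not : ∀ {A : Set} (p : A → Bool) xs → countᵇ p xs + countᵇ (not ∘ p) xs ≡ length xs
countᵇ-not p []       = refl
countᵇ-not p (x ∷ xs) with p x
... | true  = cong suc (countᵇ-not p xs)
... | false = trans (+-suc _ _) (cong suc (countᵇ-not p xs))

T-memℕ⁻ : ∀ {x} xs → T (memℕ x xs) → x ∈ xs
T-memℕ⁻ {x} xs h = Any.map (λ {y} → ≡ᵇ⇒≡ x y) (Anyₚ.any⁻ (x ≡ᵇ_) xs h)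

ValidShape : ℕ → List ℕ × ℕ → Set
ValidShape n p = IsPartition (proj₁ p) × 1 ≤ proj₂ p × length (proj₁ p) ≤ proj₂ p × partAt (proj₁ p) 1 + proj₂ p ≤ n

partAt-suc : ∀ {μ} → IsPartition μ → ∀ i → partAt μ (suc (suc i)) ≤ partAt μ (suc i)
partAt-suc {[]}        _ i                         = z≤n
partAt-suc {x ∷ []}    _ i                         = z≤n
partAt-suc {x ∷ y ∷ μ} (y≤x ∷ _ , _) zero          = y≤x
partAt-suc {x ∷ y ∷ μ} (_ ∷ l , _ ∷ a) (suc i)     = partAt-suc (l , a) i

partAt-antitone : ∀ {μ} → IsPartition μ → ∀ {i j} → i ≤ j → partAt μ (suc j) ≤ partAt μ (suc i)
partAt-antitone {μ} part {i} {j} i≤j = subst (λ x → partAt μ (suc x) ≤ partAt μ (suc i)) (m∸n+n≡m i≤j) (go (j ∸ i))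
  where
  go : ∀ e → partAt μ (suc (e + i)) ≤ partAt μ (suc i)
  go zero    = ≤-refl
  go (suc e) = ≤-trans (partAt-suc part (e + i)) (go e)

module Grassmannian (n : ℕ) (μ : List ℕ) (d : ℕ) (valid : ValidShape n (μ , d)) where

  u : ℕ → ℕ
  u = grassPerm μ d n

  part : IsPartition μ
  part = proj₁ valid

  d≤n : d ≤ n
  d≤n = ≤-trans (m≤n+m d _) (proj₂ (proj₂ (proj₂ valid)))

  partAt-≤ : ∀ i → partAt μ (suc i) ≤ n ∸ d
  partAt-≤ i = ≤-trans (partAt-antitone part z≤n) (m+n≤o⇒m≤o∸n (partAt μ 1) (proj₂ (proj₂ (proj₂ valid))))

  u-first : ∀ t → t ≤ d → u t ≡ partAt μ (suc (d ∸ t)) + t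
  u-first t t≤d rewrite ≤ᵇ-true t≤d = refl

  u-increasing : ∀ {t t′} → t < t′ → t′ ≤ d → u t < u t′
  u-increasing {t} {t′} t<t′ t′≤d rewrite u-first t (≤-trans (<⇒≤ t<t′) t′≤d) | u-first t′ t′≤d =
    +-mono-≤-< (partAt-antitone part (∸-monoʳ-≤ d (<⇒≤ t<t′))) t<t′

  u-increasing-≤ : ∀ {t t′} → t ≤ t′ → t′ ≤ d → u t ≤ u t′
  u-increasing-≤ t≤t′ t′≤d with m≤n⇒m<n∨m≡n t≤t′
  ... | inj₁ t<t′ = <⇒≤ (u-increasing t<t′ t′≤d)
  ... | inj₂ refl = ≤-refl

  u-≤-shift : ∀ t → t ≤ d → u t ≤ (n ∸ d) + t
  u-≤-shift t t≤d rewrite u-first t t≤d = +-monoˡ-≤ t (partAt-≤ (d ∸ t))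

  u-≤ : ∀ t → t ≤ d → u t ≤ n
  u-≤ t t≤d = ≤-trans (u-≤-shift t t≤d) (≤-trans (+-monoʳ-≤ (n ∸ d) t≤d) (≤-reflexive (m∸n+n≡m d≤n)))

  isRest : ℕ → Bool
  isRest v = not (memℕ v (grassFirst μ d))

  u-rest : ∀ e → u (suc e + d) ≡ nth 0 (filterᵇ isRest ([1…] n)) (suc e)
  u-rest e rewrite ≤ᵇ-false (s≤s (m≤n+m d e)) | m+n∸n≡m (suc e) d = refl

  restCount : ℕ → ℕ
  restCount j = countᵇ isRest ([1…] j)

  rest-prefix : ∀ {j} → j ≤ n → ∃ λ ys → filterᵇ isRest ([1…] n) ≡ filterᵇ isRest ([1…] j) ++ ys
  rest-prefix {j} j≤n with [1…]-prefix (n ∸ j) j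
  ... | ys , eq rewrite m∸n+n≡m j≤n = filterᵇ isRest ys ,
    trans (cong (filterᵇ isRest) eq) (filter-++ (T? ∘ isRest) ([1…] j) ys)

  u-rest-bounds : ∀ {j} e → j ≤ n → suc e ≤ restCount j → 1 ≤ u (suc e + d) × u (suc e + d) ≤ j
  u-rest-bounds {j} e j≤n e< with rest-prefix j≤n
  ... | ys , eq = subst (λ x → 1 ≤ x × x ≤ j) (sym u≡) (∈-[1…]⁻ (proj₁ (∈-filter⁻ (T? ∘ isRest) {xs = [1…] j} (nth-∈ 0 (filterᵇ isRest ([1…] j)) (suc e) (s≤s z≤n) e<))))
    where
    u≡ : u (suc e + d) ≡ nth 0 (filterᵇ isRest ([1…] j)) (suc e)
    u≡ = trans (u-rest e) (trans (cong (λ L → nth 0 L (suc e)) eq) (nth-++ 0 (filterᵇ isRest ([1…] j)) ys (suc e) (s≤s z≤n) e<))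

  -- Each v in {1,...,j} is either a rest value or u k for some k ≤ d; the distinct v of the second
  -- kind number at most the corner sum.
  ≤-cornerPerm+restCount : ∀ j → j ≤ cornerPerm u d j + restCount j
  ≤-cornerPerm+restCount j = begin
    j                                                       ≡⟨ length-[1…] j ⟨
    length ([1…] j)                                         ≡⟨ countᵇ-not isFirst ([1…] j) ⟨
    countᵇ isFirst ([1…] j) + countᵇ (not ∘ isFirst) ([1…] j) ≤⟨ +-monoˡ-≤ (restCount j) first≤ ⟩
    cornerPerm u d j + restCount j                          ∎
    where
    open ≤-Reasoning
    isFirst : ℕ → Bool
    isFirst v = memℕ v (grassFirst μ d)
    sub : ∀ {v} → v ∈ filterᵇ isFirst ([1…] j) → v ∈ map u (filterᵇ (λ k → u k ≤ᵇ j) ([1…] d))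
    sub {v} v∈ with ∈-filter⁻ (T? ∘ isFirst) {xs = [1…] j} v∈
    ... | v∈j , first with ∈-map⁻ (λ t → partAt μ (suc (d ∸ t)) + t) (T-memℕ⁻ (grassFirst μ d) first)
    ...   | t , t∈ , v≡ = subst (_∈ map u (filterᵇ (λ k → u k ≤ᵇ j) ([1…] d))) (sym v≡u)
              (∈-map⁺ u (∈-filter⁺ (T? ∘ (λ k → u k ≤ᵇ j)) t∈ (≤⇒≤ᵇ (subst (_≤ j) v≡u (proj₂ (∈-[1…]⁻ v∈j))))))
      where
      v≡u : v ≡ u t
      v≡u = trans v≡ (sym (u-first t (proj₂ (∈-[1…]⁻ t∈))))
    first≤ : countᵇ isFirst ([1…] j) ≤ cornerPerm u d j
    first≤ = ≤-trans (unique-⊆-length (Uniqueₚ.filter⁺ (T? ∘ isFirst) ([1…]-unique j)) sub)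
      (≤-reflexive (length-map u (filterᵇ (λ k → u k ≤ᵇ j) ([1…] d))))

  1≤u : ∀ t → 1 ≤ t → t ≤ n → 1 ≤ u t
  1≤u t 1≤t t≤n with t ≤? d
  ... | yes t≤d rewrite u-first t t≤d = ≤-trans 1≤t (m≤n+m t _)
  ... | no t≰d = subst (λ x → 1 ≤ u x) suc-e+d≡t (proj₁ (u-rest-bounds e ≤-refl e<))
    where
    e = t ∸ suc d
    suc-e+d≡t : suc e + d ≡ t
    suc-e+d≡t = trans (sym (+-suc e d)) (m∸n+n≡m (≰⇒> t≰d))
    e< : suc e ≤ restCount n
    e< = +-cancelˡ-≤ d _ _ (begin
      d + suc e                         ≡⟨ trans (+-comm d (suc e)) suc-e+d≡t ⟩
      t                                 ≤⟨ t≤n ⟩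
      n                                 ≤⟨ ≤-cornerPerm+restCount n ⟩
      cornerPerm u d n + restCount n    ≤⟨ +-monoˡ-≤ (restCount n) (cornerPerm-≤ u d n) ⟩
      d + restCount n                   ∎)
      where open ≤-Reasoning

  -- Beyond position d the rest values appear in increasing order, so each further row adds one to
  -- the corner sum until all rest values up to j are used up; by then the sum has reached j.
  cornerPerm-u-lower : ∀ e j → j ≤ n → (cornerPerm u d j + e) ⊓ j ≤ cornerPerm u (e + d) j
  cornerPerm-u-lower e j j≤n = ≤-trans
    (⊓-glb (m⊓n≤m (r + e) j) (≤-trans (m⊓n≤n (r + e) j) (≤-cornerPerm+restCount j))) (go e)
    where
    r = cornerPerm u d j
    x = restCount j
    go : ∀ e → (r + e) ⊓ (r + x) ≤ cornerPerm u (e + d) j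
    go zero = ≤-trans (m⊓n≤m (r + 0) _) (≤-reflexive (+-identityʳ r))
    go (suc e) with suc e ≤? x
    ... | no e≮x = ≤-trans (m⊓n≤n (r + suc e) _) (≤-trans
          (⊓-glb (+-monoʳ-≤ r (s≤s⁻¹ (≰⇒> e≮x))) ≤-refl) (≤-trans (go e) (cornerPerm-mono-suc u (e + d) j)))
    ... | yes e<x rewrite cornerPerm-suc u (e + d) j | ≤ᵇ-true (proj₂ (u-rest-bounds e j≤n e<x)) = begin
      (r + suc e) ⊓ (r + x)        ≤⟨ m⊓n≤m (r + suc e) _ ⟩
      r + suc e                    ≡⟨ +-suc r e ⟩
      suc (r + e)                  ≤⟨ s≤s (⊓-glb ≤-refl (+-monoʳ-≤ r (<⇒≤ e<x))) ⟩
      suc ((r + e) ⊓ (r + x))      ≤⟨ s≤s (go e) ⟩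
      suc (cornerPerm u (e + d) j) ≡⟨ +-comm 1 _ ⟩
      cornerPerm u (e + d) j + 1   ∎
      where open ≤-Reasoning

  cornerPerm-u-n : ∀ i → i ≤ n → i ≤ cornerPerm u i n
  cornerPerm-u-n i i≤n with i ≤? d
  ... | yes i≤d = cornerPerm-full u i n (λ k _ k≤i → u-≤ k (≤-trans k≤i i≤d))
  ... | no  i≰d = subst (λ x → x ≤ cornerPerm u x n) (m∸n+n≡m (≰⇒≥ i≰d)) (≤-trans
    (⊓-glb (≤-trans (≤-reflexive (+-comm e d)) (+-monoˡ-≤ e (cornerPerm-full u d n (λ k _ → u-≤ k))))
           (≤-trans (≤-reflexive (m∸n+n≡m (≰⇒≥ i≰d))) i≤n))
    (cornerPerm-u-lower e n ≤-refl))
    where e = i ∸ d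

  n-cornerPerm-u : ∀ j → j ≤ n → j ≤ cornerPerm u n j
  n-cornerPerm-u j j≤n = subst (λ x → j ≤ cornerPerm u x j) (m∸n+n≡m d≤n)
    (≤-trans (⊓-glb j≤ ≤-refl) (cornerPerm-u-lower e j j≤n))
    where
    e = n ∸ d
    -- Since u k ≤ (n - d) + k, at least j - (n - d) of the first d values are at most j.
    p = j ∸ e
    p≤d : p ≤ d
    p≤d = m≤n+o⇒m∸n≤o j e (≤-trans j≤n (≤-reflexive (sym (m∸n+n≡m d≤n))))
    u-small : ∀ k → 1 ≤ k → k ≤ p → u k ≤ j
    u-small k 1≤k k≤p = begin
      u k         ≤⟨ u-≤-shift k (≤-trans k≤p p≤d) ⟩
      e + k       ≤⟨ +-monoʳ-≤ e k≤p ⟩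
      e + (j ∸ e) ≡⟨ m+[n∸m]≡n (<⇒≤ (m∸n≢0⇒n<m {j} {e} λ p≡0 → contradiction (subst (1 ≤_) p≡0 (≤-trans 1≤k k≤p)) λ ())) ⟩
      j           ∎
      where open ≤-Reasoning
    j≤ : j ≤ cornerPerm u d j + e
    j≤ = begin
      j                       ≤⟨ m≤n+m∸n j e ⟩
      e + p                   ≡⟨ +-comm e p ⟩
      p + e                   ≤⟨ +-monoˡ-≤ e (≤-trans (cornerPerm-full u p j u-small) (cornerPerm-monoˡ u j p≤d)) ⟩
      cornerPerm u d j + e    ∎
      where open ≤-Reasoning

  cornerPerm-u-0 : ∀ i → i ≤ n → cornerPerm u i 0 ≡ 0
  cornerPerm-u-0 i i≤n = n≤0⇒n≡0 (cornerPerm-bounded u 0 i 0 (λ k 1≤k k≤i → 1≤u k 1≤k (≤-trans k≤i i≤n)))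

  module Compare (δ : ℕ → ℕ) (δ-≤ : ∀ i j → cornerPerm δ i j ≤ j) where

    -- Here j + 1 = u (d - k). This is the tableau criterion for Bruhat order in row d: the (k +
    -- 1)-st largest of the first d values of δ is at least the (k + 1)-st largest of those of u.
    Essential : Set
    Essential = ∀ k j → k < d → suc j + k ≡ d + partAt μ (suc k) → suc k ≤ above δ j d

    u-at : ∀ {k j t} → suc t + k ≡ d → suc j + k ≡ d + partAt μ (suc k) → u (suc t) ≡ suc j
    u-at {k} {j} {t} refl eq = +-cancelʳ-≡ k _ _ (begin
      u (suc t) + k                              ≡⟨ cong (_+ k) (u-first (suc t) (m≤m+n _ k)) ⟩
      partAt μ (suc (t + k ∸ t)) + suc t + k     ≡⟨ cong (λ x → partAt μ (suc x) + suc t + k) (m+n∸m≡n t k) ⟩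
      partAt μ (suc k) + suc t + k               ≡⟨ +-assoc (partAt μ (suc k)) (suc t) k ⟩
      partAt μ (suc k) + (suc t + k)             ≡⟨ +-comm (partAt μ (suc k)) _ ⟩
      suc t + k + partAt μ (suc k)               ≡⟨ eq ⟨
      suc j + k                                  ∎)
      where open ≡-Reasoning

    above-cornerPerm : ∀ {k j t} → suc t + k ≡ d → suc k ≤ above δ j d ⇔ cornerPerm δ d j ≤ t
    above-cornerPerm {k} {j} {t} eq = mk⇔
      (λ k< → +-cancelʳ-≤ (above δ j d) _ _ (begin
        cornerPerm δ d j + above δ j d   ≡⟨ sum≡ ⟩
        t + suc k                        ≤⟨ +-monoʳ-≤ t k< ⟩
        t + above δ j d                  ∎))
      (λ r≤ → +-cancelˡ-≤ t _ _ (begin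
        t + suc k                        ≡⟨ sum≡ ⟨
        cornerPerm δ d j + above δ j d   ≤⟨ +-monoˡ-≤ (above δ j d) r≤ ⟩
        t + above δ j d                  ∎))
      where
      open ≤-Reasoning
      sum≡ : cornerPerm δ d j + above δ j d ≡ t + suc k
      sum≡ = trans (cornerPerm+above δ d j) (trans (sym eq) (sym (+-suc t k)))

    position : ∀ {k} → k < d → ∃ λ t → suc t + k ≡ d
    position {k} k<d = d ∸ suc k , trans (sym (+-suc _ k)) (m∸n+n≡m k<d)

    dominated⇒essential : (∀ j → 1 ≤ j → j ≤ n → cornerPerm δ d j ≤ cornerPerm u d j) → Essential
    dominated⇒essential h k j k<d eq with position k<d
    ... | t , t≡ = from (above-cornerPerm t≡) (r≤ j (u-at t≡ eq))
      where
      r≤ : ∀ j → u (suc t) ≡ suc j → cornerPerm δ d j ≤ t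
      -- Column 0 is outside the range of the hypothesis h; the general bound on corner sums of δ
      -- covers it.
      r≤ zero    u≡ = ≤-trans (δ-≤ d 0) z≤n
      r≤ (suc j) u≡ = ≤-trans (h (suc j) (s≤s z≤n) (≤-trans (n≤1+n _) (subst (_≤ n) u≡ (u-≤ (suc t) st≤d))))
        (cornerPerm-bounded u t d (suc j) λ k t<k k≤d → subst (_≤ u k) u≡ (u-increasing-≤ t<k k≤d))
        where
        st≤d : suc t ≤ d
        st≤d = subst (suc t ≤_) t≡ (m≤m+n (suc t) _)

    -- In a row i ≤ d, u is increasing, so its corner sum is either i, the trivial maximum, or at
    -- least the corner sum of δ in row d. In rows beyond d the corner sum of δ grows by at most one
    -- per row and stays at most j, while that of u grows as fast as these bounds permit.
    essential⇒dominated : Essential → ∀ i j → i ≤ n → j ≤ n → cornerPerm δ i j ≤ cornerPerm u i j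
    essential⇒dominated ess = dominated
      where
      at-u : ∀ t → suc t ≤ d → ∀ j → u (suc t) ≡ suc j → cornerPerm δ d j ≤ t
      at-u t t<d j u≡ = to (above-cornerPerm t≡) (ess k j (∸-monoʳ-< {d} z<s t<d) (begin
          suc j + k                                      ≡⟨ cong (_+ k) u≡ ⟨
          u (suc t) + k                                  ≡⟨ cong (_+ k) (u-first (suc t) t<d) ⟩
          partAt μ (suc k) + suc t + k                   ≡⟨ +-assoc (partAt μ (suc k)) (suc t) k ⟩
          partAt μ (suc k) + (suc t + k)                 ≡⟨ cong (partAt μ (suc k) +_) t≡ ⟩
          partAt μ (suc k) + d                           ≡⟨ +-comm _ d ⟩
          d + partAt μ (suc k)                           ∎))
        where
        open ≡-Reasoning
        k = d ∸ suc t
        t≡ : suc t + k ≡ d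
        t≡ = m+[n∸m]≡n t<d
      first : ∀ i j → i ≤ d → cornerPerm δ d j ≤ cornerPerm u i j ⊎ i ≤ cornerPerm u i j
      first zero    j i≤d = inj₂ z≤n
      first (suc i) j i<d with u (suc i) ≤? j
      ... | yes u≤j = inj₂ (cornerPerm-full u (suc i) j λ k _ k≤i → ≤-trans (u-increasing-≤ k≤i i<d) u≤j)
      ... | no  u≰j with first i j (<⇒≤ i<d)
      ...   | inj₁ r≤ = inj₁ (≤-trans r≤ (cornerPerm-mono-suc u i j))
      ...   | inj₂ i≤ = inj₁ (≤-trans (small (u (suc i)) refl (≰⇒> u≰j)) (≤-trans i≤ (cornerPerm-mono-suc u i j)))
        where
        small : ∀ v → u (suc i) ≡ v → j < v → cornerPerm δ d j ≤ i
        small (suc v) u≡ j<v = ≤-trans (cornerPerm-monoʳ δ d (s≤s⁻¹ j<v)) (at-u i i<d v u≡)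
      dominated-first : ∀ i j → i ≤ d → cornerPerm δ i j ≤ cornerPerm u i j
      dominated-first i j i≤d with first i j i≤d
      ... | inj₁ r≤ = ≤-trans (cornerPerm-monoˡ δ j i≤d) r≤
      ... | inj₂ i≤ = ≤-trans (cornerPerm-≤ δ i j) i≤
      dominated : ∀ i j → i ≤ n → j ≤ n → cornerPerm δ i j ≤ cornerPerm u i j
      dominated i j i≤n j≤n with i ≤? d
      ... | yes i≤d = dominated-first i j i≤d
      ... | no  i≰d = subst (λ x → cornerPerm δ x j ≤ cornerPerm u x j) (m∸n+n≡m (≰⇒≥ i≰d)) (≤-trans
        (⊓-glb (≤-trans (cornerPerm-+-≤ δ e d j) (+-monoˡ-≤ e (dominated-first d j ≤-refl))) (δ-≤ (e + d) j))
        (cornerPerm-u-lower e j j≤n))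
        where e = i ∸ d

-- Corner sums of the join, extended by an identity block

minList-≤ : ∀ {xs x} → x ∈ xs → minList xs ≤ x
minList-≤ {x ∷ []}     (here refl) = ≤-refl
minList-≤ {x ∷ y ∷ xs} (here refl) = m⊓n≤m x _
minList-≤ {x ∷ y ∷ xs} (there x∈)  = ≤-trans (m⊓n≤n x _) (minList-≤ x∈)

minList-glb : ∀ {xs q} → xs ≢ [] → All (q ≤_) xs → q ≤ minList xs
minList-glb {[]}         ≢[] _         = contradiction refl ≢[]
minList-glb {x ∷ []}     _   (q≤ ∷ []) = q≤
minList-glb {x ∷ y ∷ xs} _   (q≤ ∷ a)  = ⊓-glb q≤ (minList-glb (λ ()) a)

sumℤ-++ : ∀ xs ys → sumℤ (xs ++ ys) ≡ sumℤ xs ℤ.+ sumℤ ys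
sumℤ-++ []       ys = sym (ℤₚ.+-identityˡ _)
sumℤ-++ (x ∷ xs) ys = trans (cong (λ z → x ℤ.+ z) (sumℤ-++ xs ys)) (sym (ℤₚ.+-assoc x _ _))

sumℤ-∷ʳ : ∀ xs x → sumℤ (xs ∷ʳ x) ≡ sumℤ xs ℤ.+ x
sumℤ-∷ʳ xs x = trans (sumℤ-++ xs (x ∷ [])) (cong (λ z → sumℤ xs ℤ.+ z) (ℤₚ.+-identityʳ x))

add-difference : ∀ x y → x ℤ.+ (y ℤ.- x) ≡ y
add-difference x y = begin
  x ℤ.+ (y ℤ.- x)         ≡⟨ cong (λ z → x ℤ.+ z) (ℤₚ.+-comm y (ℤ.- x)) ⟩
  x ℤ.+ (ℤ.- x ℤ.+ y)     ≡⟨ ℤₚ.+-assoc x (ℤ.- x) y ⟨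
  x ℤ.- x ℤ.+ y           ≡⟨ cong (ℤ._+ y) (ℤₚ.+-inverseʳ x) ⟩
  ℤ.0ℤ ℤ.+ y              ≡⟨ ℤₚ.+-identityˡ y ⟩
  y                       ∎
  where open ≡-Reasoning

module Join (n : ℕ) (D : Data) (valid : ValidData n D) where

  r : ℕ → ℕ → ℕ
  r = joinCorner n D

  corners : ℕ → ℕ → List ℕ × ℕ → ℕ
  corners i j p = cornerPerm (grassPerm (proj₁ p) (proj₂ p) n) i j

  -- `minList []` is 0, so a bound valid for all colors passes to the minimum only because D is
  -- nonempty.
  r-glb : ∀ q i j → (∀ p → p ∈ D → q ≤ corners i j p) → q ≤ r i j
  r-glb q i j h = minList-glb nonempty (Allₚ.map⁺ (All.tabulate (h _)))
    where
    map-[] : ∀ xs → map (corners i j) xs ≡ [] → xs ≡ []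
    map-[] [] _ = refl
    nonempty : map (corners i j) D ≢ []
    nonempty eq = proj₁ valid (map-[] D eq)

  r-≤ : ∀ i j {p} → p ∈ D → r i j ≤ corners i j p
  r-≤ i j p∈ = minList-≤ (∈-map⁺ (corners i j) p∈)

  validAt : ∀ {p} → p ∈ D → ValidShape n p
  validAt = All.lookup (proj₂ valid)

  r≡0 : ∀ i j → (∀ {p} → p ∈ D → corners i j p ≡ 0) → r i j ≡ 0
  r≡0 i j h = go D (proj₁ valid) (λ {p} p∈ → subst (r i j ≤_) (h p∈) (r-≤ i j p∈))
    where
    go : ∀ xs → xs ≢ [] → (∀ {p} → p ∈ xs → r i j ≤ 0) → r i j ≡ 0
    go []       ≢[] _ = contradiction refl ≢[]
    go (p ∷ xs) _   h = n≤0⇒n≡0 (h (here refl))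

  r-0ʳ : ∀ i → i ≤ n → r i 0 ≡ 0
  r-0ʳ i i≤n = r≡0 i 0 λ {p} p∈ → Grassmannian.cornerPerm-u-0 n (proj₁ p) (proj₂ p) (validAt p∈) i i≤n

  r-0ˡ : ∀ j → r 0 j ≡ 0
  r-0ˡ j = r≡0 0 j λ _ → refl

  rowSum : ℕ → ℕ → ℤ.ℤ
  rowSum k j = sumℤ (map (plusIdEntry n D k) ([1…] j))

  rowSum-suc : ∀ k j → rowSum k (suc j) ≡ rowSum k j ℤ.+ plusIdEntry n D k (suc j)
  rowSum-suc k j = trans (cong (sumℤ ∘ map (plusIdEntry n D k)) ([1…]-suc j))
    (trans (cong sumℤ (map-++ (plusIdEntry n D k) ([1…] j) _)) (sumℤ-∷ʳ (map (plusIdEntry n D k) ([1…] j)) _))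

  -- `joinEntry` is a mixed second difference of r, so its row sums telescope. The boundary term
  -- vanishes since r is 0 in column 0, and columns beyond n contribute 0.
  rowSum-top : ∀ k j → suc k ≤ n → rowSum (suc k) j ≡ ℤ.+ r (suc k) (j ⊓ n) ℤ.- ℤ.+ r k (j ⊓ n)
  rowSum-top k zero    k<n rewrite r-0ʳ (suc k) k<n | r-0ʳ k (<⇒≤ k<n) = refl
  rowSum-top k (suc j) k<n with suc j ≤? n
  ... | yes j<n = begin
    rowSum (suc k) (suc j)                                  ≡⟨ rowSum-suc (suc k) j ⟩
    rowSum (suc k) j ℤ.+ plusIdEntry n D (suc k) (suc j)    ≡⟨ cong₂ ℤ._+_ prev entry≡ ⟩
    Δ j ℤ.+ (Δ (suc j) ℤ.- Δ j)                             ≡⟨ add-difference (Δ j) (Δ (suc j)) ⟩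
    Δ (suc j)                                               ≡⟨ cong Δ (m≤n⇒m⊓n≡m j<n) ⟨
    Δ (suc j ⊓ n)                                           ∎
    where
    open ≡-Reasoning
    Δ : ℕ → ℤ.ℤ
    Δ j = ℤ.+ r (suc k) j ℤ.- ℤ.+ r k j
    prev : rowSum (suc k) j ≡ Δ j
    prev = trans (rowSum-top k j k<n) (cong Δ (m≤n⇒m⊓n≡m (<⇒≤ j<n)))
    entry≡ : plusIdEntry n D (suc k) (suc j) ≡ Δ (suc j) ℤ.- Δ j
    entry≡ = cong₂ (λ x y → if x ∧ y then joinEntry n D (suc k) (suc j) else
      (if (n <ᵇ suc k) ∧ (suc k ≡ᵇ suc j) then ℤ.+ 1 else ℤ.+ 0)) (≤ᵇ-true k<n) (≤ᵇ-true j<n)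
  ... | no j≮n = begin
    rowSum (suc k) (suc j)                                  ≡⟨ rowSum-suc (suc k) j ⟩
    rowSum (suc k) j ℤ.+ plusIdEntry n D (suc k) (suc j)    ≡⟨ cong₂ ℤ._+_ (rowSum-top k j k<n) entry≡ ⟩
    Δ (j ⊓ n) ℤ.+ ℤ.0ℤ                                      ≡⟨ ℤₚ.+-identityʳ _ ⟩
    Δ (j ⊓ n)                                               ≡⟨ cong Δ (trans (m≥n⇒m⊓n≡n (s≤s⁻¹ (≰⇒> j≮n))) (sym (m≥n⇒m⊓n≡n (≰⇒≥ j≮n)))) ⟩
    Δ (suc j ⊓ n)                                           ∎
    where
    open ≡-Reasoning
    Δ : ℕ → ℤ.ℤ
    Δ j = ℤ.+ r (suc k) j ℤ.- ℤ.+ r k j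
    entry≡ : plusIdEntry n D (suc k) (suc j) ≡ ℤ.0ℤ
    entry≡ rewrite ≤ᵇ-true k<n | ≤ᵇ-false (≰⇒> j≮n) | <ᵇ-false k<n = refl

  rowSum-bottom : ∀ k j → n ≤ k → rowSum (suc k) j ≡ ℤ.+ bit (k <ᵇ j)
  rowSum-bottom k zero    n≤k = refl
  rowSum-bottom k (suc j) n≤k = trans (rowSum-suc (suc k) j) (trans (cong₂ ℤ._+_ (rowSum-bottom k j n≤k) entry≡) (cong ℤ.+_ sum≡))
    where
    entry≡ : plusIdEntry n D (suc k) (suc j) ≡ ℤ.+ bit (k ≡ᵇ j)
    entry≡ rewrite ≤ᵇ-false (s≤s n≤k) | <ᵇ-true (s≤s n≤k) with k ≡ᵇ j
    ... | true  = refl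
    ... | false = refl
    sum≡ : bit (k <ᵇ j) + bit (k ≡ᵇ j) ≡ bit (k <ᵇ suc j)
    sum≡ with <-cmp k j
    ... | tri< k<j k≢j _ rewrite <ᵇ-true k<j | ≡ᵇ-false k≢j | <ᵇ-true (m≤n⇒m≤1+n k<j) = refl
    ... | tri≈ k≮j refl _ rewrite <ᵇ-false (≤-refl {k}) | ≡ᵇ-true {k} refl | <ᵇ-true (n<1+n k) = refl
    ... | tri> k≮j k≢j j<k rewrite <ᵇ-false (<⇒≤ j<k) | ≡ᵇ-false k≢j | <ᵇ-false j<k = refl

  plusIdCorner-suc : ∀ i j → plusIdCorner n D (suc i) j ≡ plusIdCorner n D i j ℤ.+ rowSum (suc i) j
  plusIdCorner-suc i j = begin
    sumℤ (concatMap row′ ([1…] (suc i)))                           ≡⟨ cong (sumℤ ∘ concatMap row′) ([1…]-suc i) ⟩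
    sumℤ (concatMap row′ ([1…] i ∷ʳ suc i))                        ≡⟨ cong sumℤ (concatMap-++ row′ ([1…] i) _) ⟩
    sumℤ (concatMap row′ ([1…] i) ++ concatMap row′ (suc i ∷ []))  ≡⟨ sumℤ-++ (concatMap row′ ([1…] i)) _ ⟩
    plusIdCorner n D i j ℤ.+ sumℤ (row′ (suc i) ++ [])             ≡⟨ cong (λ xs → plusIdCorner n D i j ℤ.+ sumℤ xs) (++-identityʳ (row′ (suc i))) ⟩
    plusIdCorner n D i j ℤ.+ rowSum (suc i) j                      ∎
    where
    open ≡-Reasoning
    row′ : ℕ → List ℤ.ℤ
    row′ k = map (plusIdEntry n D k) ([1…] j)

  -- The row sums telescope once more; the second summand counts the ones of the identity block
  -- within the corner.
  plusIdCorner≡ : ∀ i j → plusIdCorner n D i j ≡ ℤ.+ (r (i ⊓ n) (j ⊓ n) + ((i ⊓ j) ∸ n))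
  plusIdCorner≡ zero    j rewrite r-0ˡ (j ⊓ n) | 0∸n≡0 n = refl
  plusIdCorner≡ (suc i) j with suc i ≤? n
  ... | yes i<n = begin
    plusIdCorner n D (suc i) j                                   ≡⟨ plusIdCorner-suc i j ⟩
    plusIdCorner n D i j ℤ.+ rowSum (suc i) j                    ≡⟨ cong₂ ℤ._+_ (trans (plusIdCorner≡ i j) prev) (rowSum-top i j i<n) ⟩
    ℤ.+ r i j′ ℤ.+ (ℤ.+ r (suc i) j′ ℤ.- ℤ.+ r i j′)                ≡⟨ add-difference (ℤ.+ r i j′) (ℤ.+ r (suc i) j′) ⟩
    ℤ.+ r (suc i) j′                                              ≡⟨ collapse (suc i) i<n ⟨
    ℤ.+ (r (suc i ⊓ n) j′ + ((suc i ⊓ j) ∸ n))                    ∎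
    where
    open ≡-Reasoning
    j′ = j ⊓ n
    collapse : ∀ i → i ≤ n → ℤ.+ (r (i ⊓ n) j′ + ((i ⊓ j) ∸ n)) ≡ ℤ.+ r i j′
    collapse i i≤n rewrite m≤n⇒m⊓n≡m i≤n | m≤n⇒m∸n≡0 (≤-trans (m⊓n≤m i j) i≤n) = cong ℤ.+_ (+-identityʳ _)
    prev = collapse i (<⇒≤ i<n)
  ... | no i≮n = begin
    plusIdCorner n D (suc i) j                                          ≡⟨ plusIdCorner-suc i j ⟩
    plusIdCorner n D i j ℤ.+ rowSum (suc i) j                           ≡⟨ cong₂ ℤ._+_ (plusIdCorner≡ i j) (rowSum-bottom i j n≤i) ⟩
    ℤ.+ (r (i ⊓ n) j′ + ((i ⊓ j) ∸ n) + bit (i <ᵇ j))                    ≡⟨ cong ℤ.+_ (+-assoc (r (i ⊓ n) j′) _ _) ⟩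
    ℤ.+ (r (i ⊓ n) j′ + (((i ⊓ j) ∸ n) + bit (i <ᵇ j)))                  ≡⟨ cong₂ (λ x y → ℤ.+ (r x j′ + y))
                                                                             (trans (m≥n⇒m⊓n≡n n≤i) (sym (m≥n⇒m⊓n≡n (m≤n⇒m≤1+n n≤i)))) diag≡ ⟩
    ℤ.+ (r (suc i ⊓ n) j′ + ((suc i ⊓ j) ∸ n))                           ∎
    where
    open ≡-Reasoning
    j′ = j ⊓ n
    n≤i : n ≤ i
    n≤i = s≤s⁻¹ (≰⇒> i≮n)
    diag≡ : ((i ⊓ j) ∸ n) + bit (i <ᵇ j) ≡ (suc i ⊓ j) ∸ n
    diag≡ with i <? j
    ... | yes i<j rewrite <ᵇ-true i<j | m≤n⇒m⊓n≡m (<⇒≤ i<j) | m≤n⇒m⊓n≡m i<j = trans (+-comm _ 1) (sym (+-∸-assoc 1 n≤i))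
    ... | no  i≮j rewrite <ᵇ-false (≮⇒≥ i≮j) | m≥n⇒m⊓n≡n (≮⇒≥ i≮j) | m≥n⇒m⊓n≡n (m≤n⇒m≤1+n (≮⇒≥ i≮j)) = +-identityʳ _

  plusIdCorner-inside : ∀ i j → i ≤ n → j ≤ n → plusIdCorner n D i j ≡ ℤ.+ r i j
  plusIdCorner-inside i j i≤n j≤n = trans (plusIdCorner≡ i j) (cong ℤ.+_ (trans
    (cong₂ _+_ (cong₂ r (m≤n⇒m⊓n≡m i≤n) (m≤n⇒m⊓n≡m j≤n)) (m≤n⇒m∸n≡0 (≤-trans (m⊓n≤m i j) i≤n))) (+-identityʳ _)))

  r-n : ∀ i → i ≤ n → i ≤ r i n
  r-n i i≤n = r-glb i i n λ p p∈ → Grassmannian.cornerPerm-u-n n (proj₁ p) (proj₂ p) (validAt p∈) i i≤n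

  n-r : ∀ j → j ≤ n → j ≤ r n j
  n-r j j≤n = r-glb j n j λ p p∈ → Grassmannian.n-cornerPerm-u n (proj₁ p) (proj₂ p) (validAt p∈) j j≤n

  -- Row and column sums 1 of A make the right side at least i ⊓ j outside the n by n block, where
  -- the comparison thus follows from the trivial bounds on a corner sum.
  ≤-plusIdCorner : ∀ w → (∀ i j → cornerPerm w i j ≤ j) → (∀ i j → i ≤ n → j ≤ n → cornerPerm w i j ≤ r i j) →
    ∀ i j → ℤ.+ cornerPerm w i j ℤ.≤ plusIdCorner n D i j
  ≤-plusIdCorner w w-≤ h i j = subst (ℤ.+ cornerPerm w i j ℤ.≤_) (sym (plusIdCorner≡ i j)) (ℤ.+≤+ bnd)
    where
    bnd : cornerPerm w i j ≤ r (i ⊓ n) (j ⊓ n) + ((i ⊓ j) ∸ n)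
    bnd with i ≤? n | j ≤? n
    ... | yes i≤n | yes j≤n rewrite m≤n⇒m⊓n≡m i≤n | m≤n⇒m⊓n≡m j≤n = ≤-trans (h i j i≤n j≤n) (m≤m+n _ _)
    ... | yes i≤n | no j≰n rewrite m≤n⇒m⊓n≡m i≤n | m≥n⇒m⊓n≡n (≰⇒≥ j≰n) =
      ≤-trans (≤-trans (cornerPerm-≤ w i j) (r-n i i≤n)) (m≤m+n _ _)
    ... | no i≰n | yes j≤n rewrite m≤n⇒m⊓n≡m j≤n | m≥n⇒m⊓n≡n (≰⇒≥ i≰n) =
      ≤-trans (≤-trans (w-≤ i j) (n-r j j≤n)) (m≤m+n _ _)
    ... | no i≰n | no j≰n rewrite m≥n⇒m⊓n≡n (≰⇒≥ i≰n) | m≥n⇒m⊓n≡n (≰⇒≥ j≰n) = begin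
      cornerPerm w i j        ≤⟨ ⊓-glb (cornerPerm-≤ w i j) (w-≤ i j) ⟩
      i ⊓ j                   ≤⟨ m≤n+m∸n (i ⊓ j) n ⟩
      n + ((i ⊓ j) ∸ n)       ≤⟨ +-monoˡ-≤ _ (r-n n ≤-refl) ⟩
      r n n + ((i ⊓ j) ∸ n)   ∎
      where open ≤-Reasoning

-- p contains a filling of every shape
Fillable : ℕ → Data → (Cell → Bool) → Set
Fillable n D p = ∀ {s} → s ∈ D → ∀ k → k < proj₂ s → 1 ≤ Greedy.greedy n (proj₂ s) p k (partAt (proj₁ s) (suc k))

-- By `above-greedy` the essential condition at k is positivity of the greedy entry in the last
-- column of row k. For an empty row that entry is the virtual one, suc d, and the condition is
-- void.
demazureGE⇔fillable : ∀ n D p → ValidData n D → DemazureGE n D (complement (faceOf n p)) ⇔ Fillable n D p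
demazureGE⇔fillable n D p valid = mk⇔ fwd bwd
  where
  open Join n D valid
  δ = demazure n (complement (faceOf n p))
  module Shape {s} (s∈ : s ∈ D) where
    open Grassmannian n (proj₁ s) (proj₂ s) (validAt s∈) public
    open Compare δ (cornerPerm-demazure-≤ n p) public
  fwd : DemazureGE n D (complement (faceOf n p)) → Fillable n D p
  fwd ge {s@(μ , d)} s∈ k k<d = to (Greedy.above-greedy n d p d≤n k (partAt μ (suc k)) j eq) (dominated⇒essential dom k j k<d eq)
    where
    open Shape s∈
    -- This is u (d - k) - 1.
    j = (d ∸ suc k) + partAt μ (suc k)
    eq : suc j + k ≡ d + partAt μ (suc k)
    eq = begin
      suc ((d ∸ suc k) + b + k)   ≡⟨ cong suc (trans (+-assoc (d ∸ suc k) b k) (cong ((d ∸ suc k) +_) (+-comm b k))) ⟩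
      suc ((d ∸ suc k) + (k + b)) ≡⟨ cong suc (+-assoc (d ∸ suc k) k b) ⟨
      suc ((d ∸ suc k) + k + b)   ≡⟨ cong (_+ b) (+-suc (d ∸ suc k) k) ⟨
      (d ∸ suc k) + suc k + b     ≡⟨ cong (_+ b) (m∸n+n≡m k<d) ⟩
      d + b                       ∎
      where
      open ≡-Reasoning
      b = partAt μ (suc k)
    dom : ∀ j → 1 ≤ j → j ≤ n → cornerPerm δ d j ≤ cornerPerm u d j
    dom j 1≤j j≤n = ≤-trans (ℤₚ.drop‿+≤+ (subst (ℤ.+ cornerPerm δ d j ℤ.≤_) (plusIdCorner-inside d j d≤n j≤n)
      (ge d j (proj₁ (proj₂ (validAt s∈))) (≤-trans d≤n (m≤m+n n _)) 1≤j (≤-trans j≤n (m≤m+n n _))))) (r-≤ d j s∈)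
  bwd : Fillable n D p → DemazureGE n D (complement (faceOf n p))
  bwd fill i j _ _ _ _ = ≤-plusIdCorner δ (cornerPerm-demazure-≤ n p)
    (λ i j i≤n j≤n → r-glb _ i j λ s s∈ → Shape.essential⇒dominated s∈ (ess s∈) i j i≤n j≤n) i j
    where
    ess : ∀ {s} (s∈ : s ∈ D) → Shape.Essential s∈
    ess {μ , d} s∈ k j k<d eq = from (Greedy.above-greedy n d p (Shape.d≤n s∈) k (partAt μ (suc k)) j eq) (fill s∈ k k<d)

-- Fillings and prism tableaux

-- Lookup as a relation: unlike `nth` with its default value, it carries the proof that the index is
-- in range and supports induction.
data Nth {A : Set} : List A → ℕ → A → Set where
  here  : ∀ {x xs} → Nth (x ∷ xs) 1 x
  there : ∀ {x y xs i} → Nth xs i x → Nth (y ∷ xs) (suc i) x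

Nth⇒nth : ∀ {A : Set} {xs : List A} {i x} d → Nth xs i x → nth d xs i ≡ x
Nth⇒nth d here                   = refl
Nth⇒nth d (there {i = suc i} h)  = Nth⇒nth d h

Nth-bounds : ∀ {A : Set} {xs : List A} {i x} → Nth xs i x → 1 ≤ i × i ≤ length xs
Nth-bounds here      = s≤s z≤n , s≤s z≤n
Nth-bounds (there h) = s≤s z≤n , s≤s (proj₂ (Nth-bounds h))

nth-Nth : ∀ {A : Set} d (xs : List A) i → 1 ≤ i → i ≤ length xs → Nth xs i (nth d xs i)
nth-Nth d (x ∷ xs) (suc zero)    _ _  = here
nth-Nth d (x ∷ xs) (suc (suc i)) _ i≤ = there (nth-Nth d xs (suc i) (s≤s z≤n) (s≤s⁻¹ i≤))

Nth-functional : ∀ {A : Set} {xs : List A} {i x y} → Nth xs i x → Nth xs i y → x ≡ y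
Nth-functional {x = x} h h′ = trans (sym (Nth⇒nth x h)) (Nth⇒nth x h′)

Nth-∈ : ∀ {A : Set} {xs : List A} {i x} → Nth xs i x → x ∈ xs
Nth-∈ here      = here refl
Nth-∈ (there h) = there (Nth-∈ h)

nth-ext : ∀ {A : Set} d (xs ys : List A) → length xs ≡ length ys →
  (∀ i → 1 ≤ i → i ≤ length xs → nth d xs i ≡ nth d ys i) → xs ≡ ys
nth-ext d []       []       _  _ = refl
nth-ext d (x ∷ xs) (y ∷ ys) eq h = cong₂ _∷_ (h 1 (s≤s z≤n) (s≤s z≤n)) (nth-ext d xs ys (suc-injective eq) tail≡)
  where
  tail≡ : ∀ i → 1 ≤ i → i ≤ length xs → nth d xs i ≡ nth d ys i
  tail≡ (suc i) _ i≤ = h (suc (suc i)) (s≤s z≤n) (s≤s i≤)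

nth-map-[1…] : ∀ {A : Set} d (f : ℕ → A) n i → 1 ≤ i → i ≤ n → nth d (map f ([1…] n)) i ≡ f i
nth-map-[1…] d f n (suc i) _ i< = trans (cong (λ xs → nth d xs (suc i)) (trans (sym (map-∘ (upTo n))) (map-upTo (f ∘ suc) n))) (go (f ∘ suc) n i i<)
  where
  go : ∀ g n i → suc i ≤ n → nth d (applyUpTo g n) (suc i) ≡ g i
  go g (suc n) zero    _  = refl
  go g (suc n) (suc i) i< = go (g ∘ suc) n i (s≤s⁻¹ i<)

length-map-[1…] : ∀ {A : Set} (f : ℕ → A) n → length (map f ([1…] n)) ≡ n
length-map-[1…] f n = trans (length-map f ([1…] n)) (length-[1…] n)

∈-enum : ∀ {A : Set} {xs : List A} {i x} → (i , x) ∈ enum xs ⇔ Nth xs i x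
∈-enum {A} {xs} {i} {x} rewrite map-upTo suc (length xs) = mk⇔ (λ h → fwd suc xs h) (λ h → bwd xs h)
  where
  fwd′ : ∀ f (xs : List A) {i x} → (i , x) ∈ zip (applyUpTo f (length xs)) xs → ∃ λ j → i ≡ f j × Nth xs (suc j) x
  fwd′ f (x ∷ xs) (here refl) = 0 , refl , here
  fwd′ f (x ∷ xs) (there h) with fwd′ (f ∘ suc) xs h
  ... | j , eq , nth = suc j , eq , there nth
  fwd : ∀ f (xs : List A) {i x} → (i , x) ∈ zip (applyUpTo suc (length xs)) xs → Nth xs i x
  fwd _ xs h with fwd′ suc xs h
  ... | j , refl , nth = nth
  bwd′ : ∀ f (xs : List A) {j x} → Nth xs (suc j) x → (f j , x) ∈ zip (applyUpTo f (length xs)) xs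
  bwd′ f (x ∷ xs)          here      = here refl
  bwd′ f (x ∷ xs) {suc j} (there h)  = there (bwd′ (f ∘ suc) xs h)
  bwd : ∀ (xs : List A) {i x} → Nth xs i x → (i , x) ∈ zip (applyUpTo suc (length xs)) xs
  bwd xs {zero}  h = contradiction (proj₁ (Nth-bounds h)) λ ()
  bwd xs {suc i} h = bwd′ suc xs h

HasEntry : PrismTab → ℕ → ℕ → ℕ → ℕ → Set
HasEntry 𝒯 c a b v = ∃ λ T → ∃ λ R → Nth 𝒯 c T × Nth T a R × Nth R b v

∈-entries⁻ : ∀ {𝒯 e} → e ∈ entries 𝒯 → HasEntry 𝒯 (color e) (row e) (col e) (val e)
∈-entries⁻ {𝒯} e∈ with find (∈-concatMap⁻ _ {xs = enum 𝒯} e∈)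
... | (c , T) , cT∈ , e∈T with find (∈-concatMap⁻ _ {xs = enum T} e∈T)
...   | (a , R) , aR∈ , e∈R with ∈-map⁻ _ e∈R
...     | (b , v) , bv∈ , refl = T , R , to ∈-enum cT∈ , to ∈-enum aR∈ , to ∈-enum bv∈

∈-entries⁺ : ∀ {𝒯 c a b v} → HasEntry 𝒯 c a b v → entry c a b v ∈ entries 𝒯
∈-entries⁺ (T , R , T∈ , R∈ , v∈) =
  ∈-concatMap⁺ _ (lose (from ∈-enum T∈) (∈-concatMap⁺ _ (lose (from ∈-enum R∈) (∈-map⁺ _ (from ∈-enum v∈)))))

Nth-modifyAt : ∀ {A : Set} {xs : List A} {i x} f → Nth xs i x → Nth (modifyAt i f xs) i (f x)
Nth-modifyAt f here                  = here
Nth-modifyAt f (there {i = suc i} h) = there (Nth-modifyAt f h)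

length-modifyAt : ∀ {A : Set} i f (xs : List A) → length (modifyAt i f xs) ≡ length xs
length-modifyAt zero          f []       = refl
length-modifyAt (suc zero)    f []       = refl
length-modifyAt (suc (suc i)) f []       = refl
length-modifyAt zero          f (x ∷ xs) = refl
length-modifyAt (suc zero)    f (x ∷ xs) = refl
length-modifyAt (suc (suc i)) f (x ∷ xs) = cong suc (length-modifyAt (suc i) f xs)

nth-modifyAt-other : ∀ {A : Set} d i f (xs : List A) j → j ≢ i → nth d (modifyAt i f xs) j ≡ nth d xs j
nth-modifyAt-other d zero          f []       j             j≢i = refl
nth-modifyAt-other d (suc zero)    f []       j             j≢i = refl
nth-modifyAt-other d (suc (suc i)) f []       j             j≢i = refl
nth-modifyAt-other d zero          f (x ∷ xs) j             j≢i = refl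
nth-modifyAt-other d (suc zero)    f (x ∷ xs) zero          j≢i = refl
nth-modifyAt-other d (suc zero)    f (x ∷ xs) (suc zero)    j≢i = contradiction refl j≢i
nth-modifyAt-other d (suc zero)    f (x ∷ xs) (suc (suc j)) j≢i = refl
nth-modifyAt-other d (suc (suc i)) f (x ∷ xs) zero          j≢i = refl
nth-modifyAt-other d (suc (suc i)) f (x ∷ xs) (suc zero)    j≢i = refl
nth-modifyAt-other d (suc (suc i)) f (x ∷ xs) (suc (suc j)) j≢i = nth-modifyAt-other d (suc i) f xs (suc j) (j≢i ∘ cong suc)

nth-modifyAt : ∀ {A : Set} d i f (xs : List A) → 1 ≤ i → i ≤ length xs → nth d (modifyAt i f xs) i ≡ f (nth d xs i)
nth-modifyAt d i f xs 1≤i i≤ = Nth⇒nth d (Nth-modifyAt f (nth-Nth d xs i 1≤i i≤))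

modifyAt-Nth⁻ : ∀ {A : Set} i f (xs : List A) {j y} → Nth (modifyAt i f xs) j y →
  (j ≡ i × ∃ λ x → Nth xs i x × y ≡ f x) ⊎ (j ≢ i × Nth xs j y)
modifyAt-Nth⁻ i f xs {j} {y} h with Nth-bounds h | j ≟ i
... | 1≤j , j≤ | yes refl = inj₁ (refl , nth y xs i , x∈ , trans (sym (Nth⇒nth y h)) (nth-modifyAt y i f xs 1≤j j≤′))
  where
  j≤′ = subst (i ≤_) (length-modifyAt i f xs) j≤
  x∈ = nth-Nth y xs i 1≤j j≤′
... | 1≤j , j≤ | no j≢i = inj₂ (j≢i , subst (Nth xs j) (trans (sym (nth-modifyAt-other y i f xs j j≢i)) (Nth⇒nth y h))
      (nth-Nth y xs j 1≤j (subst (j ≤_) (length-modifyAt i f xs) j≤)))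

Pointwise-Nthʳ : ∀ {A B : Set} {R : A → B → Set} {xs ys i y} → Pointwise R xs ys → Nth ys i y → ∃ λ x → Nth xs i x × R x y
Pointwise-Nthʳ (r ∷ _)  here      = _ , here , r
Pointwise-Nthʳ (_ ∷ rs) (there h) with Pointwise-Nthʳ rs h
... | x , x∈ , r = x , there x∈ , r

Pointwise-Nth : ∀ {A B : Set} {R : A → B → Set} {xs ys i x y} → Pointwise R xs ys → Nth xs i x → Nth ys i y → R x y
Pointwise-Nth (r ∷ _)  here      here       = r
Pointwise-Nth (_ ∷ _)  here      (there ())
Pointwise-Nth (_ ∷ _)  (there ()) here
Pointwise-Nth (_ ∷ rs) (there h) (there h′) = Pointwise-Nth rs h h′

Pointwise-Nthˡ : ∀ {A B : Set} {R : A → B → Set} {xs ys i x} → Pointwise R xs ys → Nth xs i x → ∃ λ y → Nth ys i y × R x y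
Pointwise-Nthˡ (r ∷ _)  here      = _ , here , r
Pointwise-Nthˡ (_ ∷ rs) (there h) with Pointwise-Nthˡ rs h
... | y , y∈ , r = y , there y∈ , r

Pointwise-modifyAt : ∀ {A B : Set} {R : A → B → Set} {xs ys i x y f} →
  Pointwise R xs ys → Nth xs i x → Nth ys i y → R x (f y) → Pointwise R xs (modifyAt i f ys)
Pointwise-modifyAt (_ ∷ rs) here      here      r = r ∷ rs
Pointwise-modifyAt (_ ∷ rs) here      (there ()) r
Pointwise-modifyAt (_ ∷ rs) (there ()) here      r
Pointwise-modifyAt (r′ ∷ rs) (there {i = suc i} h) (there h′) r = r′ ∷ Pointwise-modifyAt rs h h′ r

Shape : Set
Shape = List ℕ × ℕ

abstract
  greedyFilling : ℕ → (Cell → Bool) → Shape → Filling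
  greedyFilling n p (μ , d) = map (λ a → map (Greedy.greedy n d p (d ∸ a)) ([1…] (partAt μ (suc (d ∸ a))))) ([1…] d)

  length-greedyFilling : ∀ n p μ d → length (greedyFilling n p (μ , d)) ≡ d
  length-greedyFilling n p μ d = length-map-[1…] _ d

  rowOf-greedyFilling : ∀ n p μ d a → 1 ≤ a → a ≤ d →
    rowOf (greedyFilling n p (μ , d)) a ≡ map (Greedy.greedy n d p (d ∸ a)) ([1…] (partAt μ (suc (d ∸ a))))
  rowOf-greedyFilling n p μ d a 1≤a a≤d = nth-map-[1…] [] _ d a 1≤a a≤d

module Fillings (n : ℕ) (μ : List ℕ) (d : ℕ) (valid : ValidShape n (μ , d)) where

  open Grassmannian n μ d valid using (part; d≤n; partAt-≤)

  -- A record, so that T can be inferred from a proof.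
  record Tableau (T : Filling) : Set where
    constructor tableau
    field isFilling : IsFilling μ d T
  open Tableau public

  In : ℕ → ℕ → Set
  In = InShape μ d

  In-left : ∀ {a b} → In a (suc (suc b)) → In a (suc b)
  In-left (1≤a , a≤d , _ , b≤) = 1≤a , a≤d , s≤s z≤n , <⇒≤ b≤

  In-below : ∀ {a b} → In a b → a < d → In (suc a) b
  In-below {a} (1≤a , a≤d , 1≤b , b≤) a<d = s≤s z≤n , a<d , 1≤b , ≤-trans b≤ (partAt-antitone part (∸-monoʳ-≤ d (n≤1+n a)))

  In-antidiagonal-≤ : ∀ {a b} → In a b → a + b ≤ n
  In-antidiagonal-≤ {a} (_ , a≤d , _ , b≤) =
    ≤-trans (+-mono-≤ a≤d (≤-trans b≤ (partAt-≤ (d ∸ a)))) (≤-reflexive (m+[n∸m]≡n d≤n))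

  module _ {T : Filling} (fil : Tableau T) where

    filling-length : length T ≡ d
    filling-length = proj₁ (isFilling fil)

    filling-rowLength : ∀ a → 1 ≤ a → a ≤ d → length (rowOf T a) ≡ partAt μ (suc (d ∸ a))
    filling-rowLength = proj₁ (proj₂ (isFilling fil))

    filling-bounds : ∀ {a b} → In a b → 1 ≤ at T a b × at T a b ≤ d
    filling-bounds = proj₁ (proj₂ (proj₂ (isFilling fil))) _ _

    filling-row : ∀ {a b} → In a b → In a (suc b) → at T a (suc b) ≤ at T a b
    filling-row = proj₁ (proj₂ (proj₂ (proj₂ (isFilling fil)))) _ _

    filling-col : ∀ {a b} → In a b → In (suc a) b → at T a b < at T (suc a) b
    filling-col = proj₂ (proj₂ (proj₂ (proj₂ (isFilling fil)))) _ _

    In-Nth : ∀ {a b} → In a b → Nth T a (rowOf T a) × Nth (rowOf T a) b (at T a b)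
    In-Nth {a} {b} (1≤a , a≤d , 1≤b , b≤) =
      nth-Nth [] T a 1≤a (subst (a ≤_) (sym filling-length) a≤d) ,
      nth-Nth 0 (rowOf T a) b 1≤b (subst (b ≤_) (sym (filling-rowLength a 1≤a a≤d)) b≤)

    Nth-In : ∀ {a b R v} → Nth T a R → Nth R b v → In a b × v ≡ at T a b
    Nth-In {a} {b} {R} R∈ v∈ with Nth-bounds R∈ | Nth⇒nth [] R∈ | Nth-bounds v∈
    ... | 1≤a , a≤ | refl | 1≤b , b≤ = (1≤a , a≤d , 1≤b , subst (b ≤_) (filling-rowLength a 1≤a a≤d) b≤) , sym (Nth⇒nth 0 v∈)
      where a≤d = subst (a ≤_) filling-length a≤

    -- Each column of the shape reaches down to row d, where entries are at most d; strictness costs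
    -- at least one for each row on the way up.
    val-≤-row : ∀ k a b → a + k ≡ d → In a b → at T a b ≤ a
    val-≤-row zero    a b eq in′ = subst (at T a b ≤_) (trans (sym eq) (+-identityʳ a)) (proj₂ (filling-bounds in′))
    val-≤-row (suc k) a b eq in′ = s≤s⁻¹ (≤-trans (filling-col in′ below) (val-≤-row k (suc a) b eq′ below))
      where
      eq′ : suc a + k ≡ d
      eq′ = trans (sym (+-suc a k)) eq
      below = In-below in′ (subst (suc a ≤_) eq′ (m≤m+n (suc a) k))

    val≤row : ∀ {a b} → In a b → at T a b ≤ a
    val≤row {a} {b} in′ = val-≤-row (d ∸ a) a b (m+[n∸m]≡n (proj₁ (proj₂ in′))) in′

    cell-∈ : ∀ {a b} → In a b → (at T a b , a + b ∸ at T a b) ∈ cellsQ n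
    cell-∈ {a} {b} in′@(1≤a , a≤d , 1≤b , b≤) = ∈-cellsQ⁺ (proj₁ (filling-bounds in′)) (≤-trans (proj₂ (filling-bounds in′)) d≤n)
      (m<n⇒0<n∸m (≤-<-trans (val≤row in′) (m<m+n a 1≤b)))
      (≤-trans (m∸n≤m (a + b) (at T a b)) (In-antidiagonal-≤ in′))

    -- A staircase of steps to the left, along which entries weakly grow, and steps down, along
    -- which they strictly grow, joins the two cells. Hence one color uses a value at most once per
    -- antidiagonal.
    antidiagonal-increasing : ∀ e {a b} → In a (suc e + b) → 1 ≤ b → suc e + a ≤ d → at T a (suc e + b) < at T (suc e + a) b
    antidiagonal-increasing e {a} {suc b} in′ 1≤b a≤d = below e in′ a≤d
      where
      step : ∀ e {a} → In a (suc e + suc b) → suc a ≤ d → at T a (suc e + suc b) < at T (suc a) (e + suc b)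
      step e {a} in′ a<d rewrite +-suc e b = ≤-<-trans (filling-row (In-left in′) in′) (filling-col (In-left in′) (In-below (In-left in′) a<d))
      below : ∀ e {a} → In a (suc e + suc b) → suc e + a ≤ d → at T a (suc e + suc b) < at T (suc e + a) (suc b)
      below zero        in′ a≤d = step 0 in′ a≤d
      below (suc e) {a} in′ a≤d = <-trans (step (suc e) in′ a<d) (subst (λ x → at T (suc a) (suc e + suc b) < at T x (suc b)) eq
          (below e (In-below left a<d) (subst (_≤ d) (sym eq) a≤d)))
        where
        eq : suc e + suc a ≡ suc (suc e) + a
        eq = +-suc (suc e) a
        a<d : suc a ≤ d
        a<d = ≤-trans (s≤s (m≤n+m a (suc e))) a≤d
        left : In a (suc e + suc b)
        left = In-left in′

    antidiagonal-< : ∀ {a b a′ b′} → In a b → In a′ b′ → a + b ≡ a′ + b′ → a < a′ → at T a b < at T a′ b′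
    antidiagonal-< {a} {b} {a′} {b′} in₁ in₂ eq a<a′ = subst₂ (λ x y → at T a x < at T y b′) b≡ a′≡
        (antidiagonal-increasing e (subst (In a) (sym b≡) in₁) (proj₁ (proj₂ (proj₂ in₂))) (subst (_≤ d) (sym a′≡) (proj₁ (proj₂ in₂))))
      where
      e = a′ ∸ suc a
      a′≡ : suc e + a ≡ a′
      a′≡ = trans (sym (+-suc e a)) (m∸n+n≡m a<a′)
      b≡ : suc e + b′ ≡ b
      b≡ = +-cancelˡ-≡ a _ _ (begin
        a + (suc e + b′)   ≡⟨ +-assoc a (suc e) b′ ⟨
        a + suc e + b′     ≡⟨ cong (_+ b′) (trans (+-comm a (suc e)) a′≡) ⟩
        a′ + b′            ≡⟨ eq ⟨
        a + b              ∎)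
        where open ≡-Reasoning

    antidiagonal-injective : ∀ {a b a′ b′} → In a b → In a′ b′ → a + b ≡ a′ + b′ → at T a b ≡ at T a′ b′ → (a , b) ≡ (a′ , b′)
    antidiagonal-injective {a} {b} {a′} {b′} in₁ in₂ eq v≡ with <-cmp a a′
    ... | tri≈ _ refl _ = cong (a ,_) (+-cancelˡ-≡ a b b′ eq)
    ... | tri< a<a′ _ _ = contradiction v≡ (<⇒≢ (antidiagonal-< in₁ in₂ eq a<a′))
    ... | tri> _ _ a′<a = contradiction (sym v≡) (<⇒≢ (antidiagonal-< in₂ in₁ (sym eq) a′<a))

  filling-ext : ∀ {T T′} → Tableau T → Tableau T′ → (∀ a b → In a b → at T a b ≡ at T′ a b) → T ≡ T′
  filling-ext {T} {T′} fil fil′ h = nth-ext [] T T′ (trans (filling-length fil) (sym (filling-length fil′))) λ a 1≤a a≤ →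
    let a≤d = subst (a ≤_) (filling-length fil) a≤
        len = filling-rowLength fil a 1≤a a≤d
    in nth-ext 0 (rowOf T a) (rowOf T′ a) (trans len (sym (filling-rowLength fil′ a 1≤a a≤d))) λ b 1≤b b≤ →
         h a b (1≤a , a≤d , 1≤b , subst (b ≤_) len b≤)

  setAt : Filling → ℕ → ℕ → ℕ → Filling
  setAt T a b v = modifyAt a (modifyAt b (λ _ → v)) T

  module _ {T : Filling} (fil : Tableau T) {a b : ℕ} (in₀ : In a b) (v : ℕ) where

    private
      T′ = setAt T a b v
      a-ok : 1 ≤ a × a ≤ length T
      a-ok = proj₁ in₀ , subst (a ≤_) (sym (filling-length fil)) (proj₁ (proj₂ in₀))
      row≡ : rowOf T′ a ≡ modifyAt b (λ _ → v) (rowOf T a)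
      row≡ = nth-modifyAt [] a _ T (proj₁ a-ok) (proj₂ a-ok)

    at-setAt : at T′ a b ≡ v
    at-setAt = trans (cong (λ R → nth 0 R b) row≡) (nth-modifyAt 0 b _ (rowOf T a) (proj₁ b-ok) (proj₂ b-ok))
      where b-ok = Nth-bounds (proj₂ (In-Nth fil in₀))

    at-setAt-other : ∀ {a′ b′} → (a′ , b′) ≢ (a , b) → at T′ a′ b′ ≡ at T a′ b′
    at-setAt-other {a′} {b′} ≢ with a′ ≟ a
    ... | no a′≢a  = cong (λ R → nth 0 R b′) (nth-modifyAt-other [] a _ T a′ a′≢a)
    ... | yes refl = trans (cong (λ R → nth 0 R b′) row≡) (nth-modifyAt-other 0 b _ (rowOf T a) b′ (≢ ∘ cong (a ,_)))

    -- Raising an entry only relaxes the inequalities with the cells to its right and above it, so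
    -- the left and lower neighbours are the ones to check.
    setAt-filling : at T a b < v → v ≤ d → (∀ b′ → b ≡ suc b′ → In a b′ → v ≤ at T a b′) →
      (In (suc a) b → v < at T (suc a) b) → Tableau T′
    setAt-filling t<v v≤d left below =
      tableau (trans (length-modifyAt a _ T) (filling-length fil) , lengths , bounds , rows , cols)
      where
      _≟ᶜ_ : (c c′ : ℕ × ℕ) → Dec (c ≡ c′)
      _≟ᶜ_ = ≡-dec _≟_ _≟_
      lengths : ∀ a′ → 1 ≤ a′ → a′ ≤ d → length (rowOf T′ a′) ≡ partAt μ (suc (d ∸ a′))
      lengths a′ 1≤a′ a′≤d with a′ ≟ a
      ... | no a′≢a  = trans (cong length (nth-modifyAt-other [] a _ T a′ a′≢a)) (filling-rowLength fil a′ 1≤a′ a′≤d)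
      ... | yes refl = trans (cong length row≡) (trans (length-modifyAt b _ (rowOf T a)) (filling-rowLength fil a 1≤a′ a′≤d))
      bounds : ∀ a′ b′ → In a′ b′ → 1 ≤ at T′ a′ b′ × at T′ a′ b′ ≤ d
      bounds a′ b′ in′ with (a′ , b′) ≟ᶜ (a , b)
      ... | yes refl rewrite at-setAt = ≤-trans (proj₁ (filling-bounds fil in₀)) (<⇒≤ t<v) , v≤d
      ... | no ≢ rewrite at-setAt-other ≢ = filling-bounds fil in′
      rows : ∀ a′ b′ → In a′ b′ → In a′ (suc b′) → at T′ a′ (suc b′) ≤ at T′ a′ b′
      rows a′ b′ in′ in″ with (a′ , suc b′) ≟ᶜ (a , b) | (a′ , b′) ≟ᶜ (a , b)
      ... | yes refl | yes eq = contradiction (proj₂ (,-injective eq)) (<⇒≢ (n<1+n b′))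
      ... | yes refl | no ≢ rewrite at-setAt | at-setAt-other ≢ = left b′ refl in′
      ... | no ≢ | yes refl rewrite at-setAt | at-setAt-other ≢ = ≤-trans (filling-row fil in′ in″) (<⇒≤ t<v)
      ... | no ≢ | no ≢′ rewrite at-setAt-other ≢ | at-setAt-other ≢′ = filling-row fil in′ in″
      cols : ∀ a′ b′ → In a′ b′ → In (suc a′) b′ → at T′ a′ b′ < at T′ (suc a′) b′
      cols a′ b′ in′ in″ with (suc a′ , b′) ≟ᶜ (a , b) | (a′ , b′) ≟ᶜ (a , b)
      ... | yes refl | yes eq = contradiction (proj₁ (,-injective eq)) (<⇒≢ (n<1+n a′))
      ... | yes refl | no ≢ rewrite at-setAt | at-setAt-other ≢ = <-trans (filling-col fil in′ in″) t<v
      ... | no ≢ | yes refl rewrite at-setAt | at-setAt-other ≢ = below in″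
      ... | no ≢ | no ≢′ rewrite at-setAt-other ≢ | at-setAt-other ≢′ = filling-col fil in′ in″

  FillingCovered : (Cell → Bool) → Filling → Set
  FillingCovered p T = ∀ a b → In a b → B.T (p (at T a b , a + b ∸ at T a b))

  module _ (p : Cell → Bool) where

    open Greedy n d p

    -- Greedy entries weakly decrease along a row, so positivity in its last column gives the whole
    -- row.
    Positive : Set
    Positive = ∀ k → k < d → 1 ≤ greedy k (partAt μ (suc k))

    -- Induction from the bottom left corner: given the bound for the left and lower neighbours, the
    -- entry of T is itself a candidate in the choice of the greedy entry.
    filling-≤-greedy : ∀ {T} → Tableau T → FillingCovered p T →
      ∀ k b a → a + k ≡ d → In a (suc b) → at T a (suc b) ≤ greedy k (suc b)
    filling-≤-greedy {T} fil cov k b a eq in′ =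
      greedy-max k b (at T a (suc b)) (proj₁ (filling-bounds fil in′)) (subst (B.T ∘ allowed t) (sym s≡) ok) (left b in′) (below k eq)
      where
      t = at T a (suc b)
      s≡ : d + suc b ∸ k ≡ a + suc b
      s≡ = begin
        d + suc b ∸ k          ≡⟨ cong (λ x → x + suc b ∸ k) eq ⟨
        a + k + suc b ∸ k      ≡⟨ cong (_∸ k) (trans (+-assoc a k (suc b)) (trans (cong (a +_) (+-comm k (suc b))) (sym (+-assoc a (suc b) k)))) ⟩
        a + suc b + k ∸ k      ≡⟨ m+n∸n≡m (a + suc b) k ⟩
        a + suc b              ∎
        where open ≡-Reasoning
      ok : B.T (allowed t (a + suc b))
      ok = from T-∧ (<⇒<ᵇ (≤-<-trans (val≤row fil in′) (m<m+n a (s≤s z≤n))) ,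
                     from T-∧ (≤⇒≤ᵇ (≤-trans (In-antidiagonal-≤ in′) (m≤n+m n t)) , cov a (suc b) in′))
      left : ∀ b → In a (suc b) → at T a (suc b) ≤ greedy k b
      left zero    in′ = m≤n⇒m≤1+n (proj₂ (filling-bounds fil in′))
      left (suc b) in′ = ≤-trans (filling-row fil (In-left in′) in′) (filling-≤-greedy fil cov k b a eq (In-left in′))
      below : ∀ k → a + k ≡ d → t ≤ bound k (suc b)
      below zero    eq = proj₂ (filling-bounds fil in′)
      below (suc k) eq = pred-mono-≤ (≤-trans (filling-col fil in′ in″) (filling-≤-greedy fil cov k b (suc a) eq′ in″))
        where
        eq′ : suc a + k ≡ d
        eq′ = trans (sym (+-suc a k)) eq
        in″ = In-below in′ (subst (suc a ≤_) eq′ (m≤m+n (suc a) k))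

    private
      greedyT : Filling
      greedyT = greedyFilling n p (μ , d)

    at-greedyFilling : ∀ {a b} → In a b → at greedyT a b ≡ greedy (d ∸ a) b
    at-greedyFilling {a} {b} (1≤a , a≤d , 1≤b , b≤) =
      trans (cong (λ R → nth 0 R b) (rowOf-greedyFilling n p μ d a 1≤a a≤d)) (nth-map-[1…] 0 _ _ b 1≤b b≤)

    filling-≤-greedyFilling : ∀ {T} → Tableau T → FillingCovered p T → ∀ {a b} → In a b → at T a b ≤ at greedyT a b
    filling-≤-greedyFilling fil cov {a} {suc b} in′ rewrite at-greedyFilling in′ =
      filling-≤-greedy fil cov (d ∸ a) b a (m+[n∸m]≡n (proj₁ (proj₂ in′))) in′

    covered⇒positive : ∀ {T} → Tableau T → FillingCovered p T → Positive
    covered⇒positive fil cov k k<d with partAt μ (suc k) in eq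
    ... | zero  = s≤s z≤n
    ... | suc b = ≤-trans (proj₁ (filling-bounds fil in′)) (filling-≤-greedy fil cov k b (d ∸ k) (m∸n+n≡m (<⇒≤ k<d)) in′)
      where
      in′ : In (d ∸ k) (suc b)
      in′ = m<n⇒0<n∸m k<d , m∸n≤m d k , s≤s z≤n ,
        ≤-reflexive (sym (trans (cong (λ x → partAt μ (suc x)) (m∸[m∸n]≡n (<⇒≤ k<d))) eq))

    module _ (positive : Positive) where

      greedy-positive : ∀ {a b} → In a b → 1 ≤ greedy (d ∸ a) b
      greedy-positive {a} {b} (1≤a , a≤d , 1≤b , b≤) =
        ≤-trans (positive (d ∸ a) (∸-monoʳ-< {d} 1≤a a≤d)) (greedy-antitone (d ∸ a) b≤)

      greedyFilling-filling : Tableau greedyT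
      greedyFilling-filling = tableau (length-greedyFilling n p μ d , lengths , bounds , rows , cols)
        where
        lengths : ∀ a → 1 ≤ a → a ≤ d → length (rowOf greedyT a) ≡ partAt μ (suc (d ∸ a))
        lengths a 1≤a a≤d = trans (cong length (rowOf-greedyFilling n p μ d a 1≤a a≤d)) (length-map-[1…] _ _)
        bounds : ∀ a b → In a b → 1 ≤ at greedyT a b × at greedyT a b ≤ d
        bounds a (suc b) in′ rewrite at-greedyFilling in′ = greedy-positive in′ , greedy-≤ (d ∸ a) b
        rows : ∀ a b → In a b → In a (suc b) → at greedyT a (suc b) ≤ at greedyT a b
        rows a b in′ in″ rewrite at-greedyFilling in′ | at-greedyFilling in″ = greedy-≤-left (d ∸ a) b
        cols : ∀ a b → In a b → In (suc a) b → at greedyT a b < at greedyT (suc a) b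
        cols a (suc b) in′ in″ rewrite at-greedyFilling in′ | at-greedyFilling in″ =
          subst (λ x → greedy x (suc b) < greedy (d ∸ suc a) (suc b)) k≡ (strict (greedy k (suc b)) (subst (λ x → 1 ≤ greedy x (suc b)) (sym k≡) (greedy-positive in′)) (greedy-≤-bound k b))
          where
          k = suc (d ∸ suc a)
          k≡ : k ≡ d ∸ a
          k≡ = sym (+-∸-assoc 1 (proj₁ (proj₂ in″)))
          -- `pred` is truncated at 0, so the bound by `pred` becomes strict only for a positive
          -- entry.
          strict : ∀ x {y} → 1 ≤ x → x ≤ pred y → x < y
          strict (suc x) {suc y} _ x≤y = s≤s x≤y

      greedyFilling-covered : FillingCovered p greedyT
      greedyFilling-covered a (suc b) in′ rewrite at-greedyFilling in′ =
        subst (λ s → B.T (p (g , s ∸ g))) s≡ (proj₂ (to T-∧ (proj₂ (to (T-∧ {g <ᵇ s}) (greedy-allowed (d ∸ a) b (greedy-positive in′))))))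
        where
        g = greedy (d ∸ a) (suc b)
        s = d + suc b ∸ (d ∸ a)
        s≡ : s ≡ a + suc b
        s≡ = trans (+-∸-comm (suc b) (m∸n≤m d a)) (cong (_+ suc b) (m∸[m∸n]≡n (proj₁ (proj₂ in′))))

-- Occupied cells, faces and the bijection on facets

Pointwise-map : ∀ {A B : Set} {R : A → B → Set} (f : A → B) xs → (∀ {x} → x ∈ xs → R x (f x)) → Pointwise R xs (map f xs)
Pointwise-map f []       h = []
Pointwise-map f (x ∷ xs) h = h (here refl) ∷ Pointwise-map f xs (h ∘ there)

Pointwise-≡ : ∀ {A B : Set} {R : A → B → Set} {zs xs ys} → Pointwise R zs xs → Pointwise R zs ys →
  (∀ {i z x y} → Nth zs i z → Nth xs i x → Nth ys i y → x ≡ y) → xs ≡ ys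
Pointwise-≡ []       []         h = refl
Pointwise-≡ (_ ∷ rs) (_ ∷ rs′) h =
  cong₂ _∷_ (h here here here) (Pointwise-≡ rs rs′ λ z∈ x∈ y∈ → h (there z∈) (there x∈) (there y∈))

faceOf-⊆ : ∀ n {p q : Cell → Bool} → (∀ {c} → c ∈ cellsQ n → T (q c) → T (p c)) → faceOf n p ⊆ₘ faceOf n q
faceOf-⊆ n {p} {q} h = go (cellsQ n) h
  where
  not-≤ : ∀ x y → (T y → T x) → not x B.≤ not y
  not-≤ true  true  _ = B.b≤b
  not-≤ true  false _ = B.f≤t
  not-≤ false true  h = ⊥-elim (h tt)
  not-≤ false false _ = B.b≤b
  go : ∀ cs → (∀ {c} → c ∈ cs → T (q c) → T (p c)) → Pointwise B._≤_ (map (not ∘ p) cs) (map (not ∘ q) cs)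
  go []       h = []
  go (c ∷ cs) h = not-≤ (p c) (q c) (h (here refl)) ∷ go cs (h ∘ there)

faceOf-injective : ∀ n {p q : Cell → Bool} → faceOf n p ≡ faceOf n q → ∀ {c} → c ∈ cellsQ n → T (p c) → T (q c)
faceOf-injective n {p} {q} eq = go (cellsQ n) eq
  where
  go : ∀ cs → map (not ∘ p) cs ≡ map (not ∘ q) cs → ∀ {c} → c ∈ cs → T (p c) → T (q c)
  go (c ∷ cs) eq (here refl) = subst T (trans (sym (not-involutive (p c))) (trans (cong not (∷-injectiveˡ eq)) (not-involutive (q c))))
  go (c ∷ cs) eq (there c∈)  = go cs (∷-injectiveʳ eq) c∈

cellOf : Entry → Cell
cellOf e = val e , antidiag e ∸ val e

occupied : PrismTab → Cell → Bool
occupied 𝒯 c = memℕ² c (Pcells 𝒯)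

occupied⁺ : ∀ 𝒯 {e} → e ∈ entries 𝒯 → T (occupied 𝒯 (cellOf e))
occupied⁺ 𝒯 {e} e∈ = Anyₚ.any⁺ _ (lose (∈-map⁺ cellOf e∈)
  (from T-∧ (≡⇒≡ᵇ (val e) _ refl , ≡⇒≡ᵇ (antidiag e ∸ val e) _ refl)))

occupied⁻ : ∀ 𝒯 {c} → T (occupied 𝒯 c) → ∃ λ e → e ∈ entries 𝒯 × cellOf e ≡ c
occupied⁻ 𝒯 {i , j} h with find (Anyₚ.any⁻ _ (Pcells 𝒯) h)
... | c′ , c′∈ , eq with ∈-map⁻ cellOf c′∈
...   | e , e∈ , refl = e , e∈ , sym (cong₂ _,_ (≡ᵇ⇒≡ i _ (proj₁ (to T-∧ eq))) (≡ᵇ⇒≡ j _ (proj₂ (to (T-∧ {i ≡ᵇ val e}) eq))))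

record Covers (p : Cell → Bool) (𝒯 : PrismTab) : Set where
  constructor covers
  field covered : ∀ {e} → e ∈ entries 𝒯 → T (p (cellOf e))
open Covers

covers⇒⊆ : ∀ n {p 𝒯} → Covers p 𝒯 → faceOf n p ⊆ₘ Φ n 𝒯
covers⇒⊆ n {p} {𝒯} cov = faceOf-⊆ n λ _ occ → covered-cell (occupied⁻ 𝒯 occ)
  where
  covered-cell : ∀ {c} → (∃ λ e → e ∈ entries 𝒯 × cellOf e ≡ c) → T (p c)
  covered-cell (e , e∈ , refl) = cov .covered e∈

module PrismTableaux (n : ℕ) (D : Data) (valid : ValidData n D) where

  validAt : ∀ {s} → s ∈ D → ValidShape n s
  validAt = All.lookup (proj₂ valid)

  module At {c s} (s∈ : Nth D c s) = Fillings n (proj₁ s) (proj₂ s) (validAt (Nth-∈ s∈))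

  component : ∀ {𝒯 c s T} → IsPrismTableau D 𝒯 → (s∈ : Nth D c s) → Nth 𝒯 c T → At.Tableau s∈ T
  component pt s∈ T∈ = Fillings.tableau (Pointwise-Nth pt s∈ T∈)

  record Location (𝒯 : PrismTab) (e : Entry) : Set where
    field
      {shape}   : Shape
      {filling} : Filling
      shape∈    : Nth D (color e) shape
      filling∈  : Nth 𝒯 (color e) filling
      inside    : InShape (proj₁ shape) (proj₂ shape) (row e) (col e)
      val≡      : val e ≡ at filling (row e) (col e)

  abstract
    locate : ∀ {𝒯 e} → IsPrismTableau D 𝒯 → e ∈ entries 𝒯 → Location 𝒯 e
    locate pt e∈ with ∈-entries⁻ e∈
    ... | T , R , T∈ , R∈ , v∈ with Pointwise-Nthʳ pt T∈
    ...   | s , s∈ , fil with At.Nth-In s∈ (Fillings.tableau fil) R∈ v∈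
    ...     | in′ , v≡ = record { shape∈ = s∈ ; filling∈ = T∈ ; inside = in′ ; val≡ = v≡ }

  module _ {𝒯 : PrismTab} (pt : IsPrismTableau D 𝒯) where

    entry-∈ : ∀ {c s T a b} → Nth D c s → Nth 𝒯 c T → InShape (proj₁ s) (proj₂ s) a b → entry c a b (at T a b) ∈ entries 𝒯
    entry-∈ {T = T} {a} s∈ T∈ in′ =
      ∈-entries⁺ (T , rowOf T a , T∈ , At.In-Nth s∈ (component pt s∈ T∈) in′)

    val≤row : ∀ {e} → e ∈ entries 𝒯 → val e ≤ row e
    val≤row {e} e∈ = subst (_≤ row e) (sym val≡) (At.val≤row shape∈ (component pt shape∈ filling∈) inside)
      where open Location (locate pt e∈)

    cellOf-∈ : ∀ {e} → e ∈ entries 𝒯 → cellOf e ∈ cellsQ n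
    cellOf-∈ {e} e∈ = subst (λ v → (v , antidiag e ∸ v) ∈ cellsQ n) (sym val≡) (At.cell-∈ shape∈ (component pt shape∈ filling∈) inside)
      where open Location (locate pt e∈)

    -- The column of `cellOf e` is a truncated difference. Since values do not exceed their rows it
    -- is exact, and a cell determines value and antidiagonal.
    cellOf-≡ : ∀ {e v s} → e ∈ entries 𝒯 → v ≤ s → cellOf e ≡ (v , s ∸ v) → val e ≡ v × antidiag e ≡ s
    cellOf-≡ {e} e∈ v≤s eq with ,-injective eq
    ... | refl , eq′ = refl , ∸-cancelʳ-≡ (≤-trans (val≤row e∈) (m≤m+n (row e) (col e))) v≤s eq′

    covers-component : ∀ {p c s T} → Covers p 𝒯 → (s∈ : Nth D c s) → Nth 𝒯 c T → At.FillingCovered s∈ p T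
    covers-component cov s∈ T∈ a b in′ = cov .covered (entry-∈ s∈ T∈ in′)

    -- Each component of the tableau lies entrywise below the greedy filling for p, which is
    -- therefore positive.
    covers⇒face : ∀ {p} → Covers p 𝒯 → IsFace n D (faceOf n p)
    covers⇒face {p} cov = length-faceOf n p , from (demazureGE⇔fillable n D p valid) fill
      where
      fill : Fillable n D p
      fill s∈D with ∈⇒Nth s∈D
        where
        ∈⇒Nth : ∀ {A : Set} {xs : List A} {x} → x ∈ xs → ∃ λ i → Nth xs i x
        ∈⇒Nth (here refl) = 1 , here
        ∈⇒Nth (there x∈) with ∈⇒Nth x∈
        ... | i , h = suc i , there h
      ... | c , s∈ with Pointwise-Nthˡ pt s∈
      ...   | T , T∈ , _ = At.covered⇒positive s∈ p (component pt s∈ T∈) (covers-component cov s∈ T∈)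

    Φ-face : IsFace n D (Φ n 𝒯)
    Φ-face = covers⇒face (covers (occupied⁺ 𝒯))

    -- A tableau within P has a face containing the complement of P; maximality of the facet forces
    -- the tableau to use every cell of P.
    facet-Φ : ∀ {p} → IsFacet n D (faceOf n p) → Covers p 𝒯 → Φ n 𝒯 ≡ faceOf n p
    facet-Φ facet cov = proj₂ facet (Φ n 𝒯) Φ-face (covers⇒⊆ n cov)

  greedyTableau : (Cell → Bool) → PrismTab
  greedyTableau p = map (greedyFilling n p) D

  module _ (p : Cell → Bool) (fill : Fillable n D p) where

    abstract
      greedyTableau-prism : IsPrismTableau D (greedyTableau p)
      greedyTableau-prism = Pointwise-map (greedyFilling n p) D λ s∈ →
        Fillings.isFilling (Fillings.greedyFilling-filling n _ _ (validAt s∈) p (fill s∈))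

      greedyTableau-component : ∀ {c s T} → Nth D c s → Nth (greedyTableau p) c T → T ≡ greedyFilling n p s
      greedyTableau-component = Pointwise-Nth (Pointwise-map {R = λ s T → T ≡ greedyFilling n p s} (greedyFilling n p) D λ _ → refl)

    greedyTableau-covers : Covers p (greedyTableau p)
    greedyTableau-covers .covered {e} e∈ = subst (λ v → T (p (v , antidiag e ∸ v))) (sym val≡)
      (subst (At.FillingCovered shape∈ p) (sym (greedyTableau-component shape∈ filling∈))
        (At.greedyFilling-covered shape∈ p (fill (Nth-∈ shape∈))) (row e) (col e) inside)
      where open Location (locate greedyTableau-prism e∈)

    greedyTableau-max : ∀ {c s T₁ T₂ a b} (s∈ : Nth D c s) → Nth (greedyTableau p) c T₁ →
      At.Tableau s∈ T₂ → At.FillingCovered s∈ p T₂ → InShape (proj₁ s) (proj₂ s) a b → at T₂ a b ≤ at T₁ a b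
    greedyTableau-max {T₂ = T₂} {a} {b} s∈ T∈ fil cov in′ =
      subst (λ T → at T₂ a b ≤ at T a b) (sym (greedyTableau-component s∈ T∈)) (At.filling-≤-greedyFilling s∈ p fil cov in′)

    -- Any replacement by a larger allowed entry contradicts the maximality of the greedy filling.
    greedyTableau-stable : ¬ HasUnstableTriple D (greedyTableau p)
    greedyTableau-stable (e₁ , e₂ , e₃ , e₁∈ , _ , e₃∈ , _ , ad≡ , _ , _ , v₁<v₃ , pt′) =
      <⇒≱ v₁<v₃ (subst₂ _≤_ (at-setAt fil inside v) (sym val≡) (greedyTableau-max shape∈ filling∈ fil′ cov inside))
      where
      open Location (locate greedyTableau-prism e₁∈)
      open At shape∈
      a = row e₁
      b = col e₁
      v = val e₃
      fil : Tableau filling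
      fil = component greedyTableau-prism shape∈ filling∈
      fil′ : Tableau (setAt filling a b v)
      fil′ = component pt′ shape∈ (Nth-modifyAt _ filling∈)
      cov : FillingCovered p (setAt filling a b v)
      cov a′ b′ in″ = by-case (≡-dec _≟_ _≟_ (a′ , b′) (a , b))
        where
        by-case : Dec ((a′ , b′) ≡ (a , b)) → B.T (p (at (setAt filling a b v) a′ b′ , a′ + b′ ∸ at (setAt filling a b v) a′ b′))
        by-case (yes refl) = subst₂ (λ x s → B.T (p (x , s ∸ x))) (sym (at-setAt fil inside v)) (sym ad≡) (greedyTableau-covers .covered e₃∈)
        by-case (no ≢) = subst (λ x → B.T (p (x , a′ + b′ ∸ x))) (sym (at-setAt-other fil inside v ≢))
          (covers-component greedyTableau-prism greedyTableau-covers shape∈ filling∈ a′ b′ in″)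

  face⇒predicate : ∀ F → IsFace n D F → ∃ λ p → faceOf n p ≡ F × Fillable n D p
  face⇒predicate F face with mask→predicate {F = F} (cellsQ-unique n) (trans (proj₁ face) (sym (length-cellsQ n)))
  ... | p , refl = p , refl , to (demazureGE⇔fillable n D p valid) (proj₂ face)

  facet⇒stable : ∀ F → IsFacet n D F → ∃ λ 𝒯 → IsStableFacet n D 𝒯 × Φ n 𝒯 ≡ F
  facet⇒stable F facet with face⇒predicate F (proj₁ facet)
  ... | p , refl , fill = greedyTableau p , (pt , subst (IsFacet n D) (sym Φ≡) facet , greedyTableau-stable p fill) , Φ≡
    where
    pt = greedyTableau-prism p fill
    Φ≡ : Φ n (greedyTableau p) ≡ faceOf n p
    Φ≡ = facet-Φ pt facet (greedyTableau-covers p fill)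

  -- The second alternative also records that the surviving entry is not the replaced one, which
  -- later forces it to have another color.
  entry-replace⁻ : ∀ {𝒯 c s T a b v e} → IsPrismTableau D 𝒯 → (s∈ : Nth D c s) → Nth 𝒯 c T → InShape (proj₁ s) (proj₂ s) a b →
    At.Tableau s∈ (At.setAt s∈ T a b v) → e ∈ entries (replace 𝒯 c a b v) →
    (row e ≡ a × col e ≡ b × val e ≡ v) ⊎ (e ∈ entries 𝒯 × (color e ≡ c → (row e , col e) ≢ (a , b)))
  entry-replace⁻ {𝒯} {c} {s} {T} {a} {b} {v} {e} pt s∈ T∈ in₀ fil′ e∈ with ∈-entries⁻ e∈
  ... | T″ , R , T″∈ , R∈ , v∈ with modifyAt-Nth⁻ c _ 𝒯 T″∈
  ...   | inj₂ (c≢ , T∈′) = inj₂ (∈-entries⁺ (T″ , R , T∈′ , R∈ , v∈) , λ c≡ → contradiction c≡ c≢)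
  ...   | inj₁ (refl , T₁ , T₁∈ , T″≡) with Nth-functional T∈ T₁∈ | T″≡
  ...     | refl | refl with At.Nth-In s∈ fil′ R∈ v∈
  ...       | in′ , v≡ with ≡-dec _≟_ _≟_ (row e , col e) (a , b)
  ...         | yes refl = inj₁ (refl , refl , trans v≡ (At.at-setAt s∈ (component pt s∈ T∈) in₀ v))
  ...         | no ≢ = inj₂ (subst (λ x → entry c (row e) (col e) x ∈ entries 𝒯)
    (sym (trans v≡ (At.at-setAt-other s∈ (component pt s∈ T∈) in₀ v ≢))) (entry-∈ pt s∈ T∈ in′) , λ _ → ≢)

  -- In a stable facet tableau no single entry can be raised within the occupied cells: the raised
  -- tableau would cover the same facet, so another color would still hold the old entry on this
  -- antidiagonal, giving an unstable triple.
  no-raise : ∀ {𝒯 c s T a b v} → IsStableFacet n D 𝒯 → (s∈ : Nth D c s) → Nth 𝒯 c T → InShape (proj₁ s) (proj₂ s) a b →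
    at T a b < v → v ≤ a → At.Tableau s∈ (At.setAt s∈ T a b v) → ¬ B.T (occupied 𝒯 (v , a + b ∸ v))
  no-raise {𝒯} {c} {s} {T₀} {a} {b} {v} (pt , facet , stable) s∈ T∈ in₀ t<v v≤a fil′ occ =
    absurd (occupied⁻ 𝒯 occ) (occupied⁻ 𝒯′ still-occupied)
    where
    𝒯′ : PrismTab
    𝒯′ = replace 𝒯 c a b v
    ℓ = at T₀ a b
    e₁∈ : entry c a b ℓ ∈ entries 𝒯
    e₁∈ = entry-∈ pt s∈ T∈ in₀
    pt′ : IsPrismTableau D 𝒯′
    pt′ = Pointwise-modifyAt pt s∈ T∈ (Fillings.isFilling fil′)
    split : ∀ {e} → e ∈ entries 𝒯′ →
      (row e ≡ a × col e ≡ b × val e ≡ v) ⊎ (e ∈ entries 𝒯 × (color e ≡ c → (row e , col e) ≢ (a , b)))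
    split = entry-replace⁻ pt s∈ T∈ in₀ fil′
    cov : Covers (occupied 𝒯) 𝒯′
    cov .covered {e} e∈ = by-case (split e∈)
      where
      by-case : (row e ≡ a × col e ≡ b × val e ≡ v) ⊎ (e ∈ entries 𝒯 × (color e ≡ c → (row e , col e) ≢ (a , b))) →
        B.T (occupied 𝒯 (cellOf e))
      by-case (inj₁ (refl , refl , refl)) = occ
      by-case (inj₂ (e∈′ , _))            = occupied⁺ 𝒯 e∈′
    still-occupied : B.T (occupied 𝒯′ (ℓ , a + b ∸ ℓ))
    still-occupied = faceOf-injective n (sym (facet-Φ pt′ facet cov)) (cellOf-∈ pt e₁∈) (occupied⁺ 𝒯 e₁∈)
    triple : ∀ {e₂ e₃} → e₂ ∈ entries 𝒯 → e₃ ∈ entries 𝒯 → (color e₂ ≡ c → (row e₂ , col e₂) ≢ (a , b)) →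
      val e₃ ≡ v × antidiag e₃ ≡ a + b → val e₂ ≡ ℓ × antidiag e₂ ≡ a + b → ⊥
    triple {e₂} {e₃} e₂∈ e₃∈ elsewhere (v₃ , ad₃) (v₂ , ad₂) = stable (entry c a b ℓ , e₂ , e₃ , e₁∈ , e₂∈ , e₃∈ ,
      sym ad₂ , sym ad₃ , sym v₂ , c≢ , subst (ℓ <_) (sym v₃) t<v , subst (λ x → IsPrismTableau D (replace 𝒯 c a b x)) (sym v₃) pt′)
      where
      open Location (locate pt e₂∈)
      -- Within one color a value occurs once per antidiagonal, so an entry ℓ of color c would sit
      -- at (a, b), where the entry has been replaced.
      c≢ : c ≢ color e₂
      c≢ c≡ = same-color shape∈ filling∈ inside val≡ c≡
        where
        same-color : ∀ {c′ s′ T′} → Nth D c′ s′ → Nth 𝒯 c′ T′ → InShape (proj₁ s′) (proj₂ s′) (row e₂) (col e₂) →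
          val e₂ ≡ at T′ (row e₂) (col e₂) → c ≢ c′
        same-color s∈′ T∈′ in₂ v≡ refl with Nth-functional s∈ s∈′ | Nth-functional T∈ T∈′
        ... | refl | refl = elsewhere (sym c≡) (At.antidiagonal-injective s∈ (component pt s∈ T∈) in₂ in₀ ad₂ (trans (sym v≡) v₂))
    absurd : (∃ λ e → e ∈ entries 𝒯 × cellOf e ≡ (v , a + b ∸ v)) → (∃ λ e → e ∈ entries 𝒯′ × cellOf e ≡ (ℓ , a + b ∸ ℓ)) → ⊥
    absurd (e₃ , e₃∈ , eq₃) (e₂ , e₂∈′ , eq₂) = by-case (split e₂∈′)
      where
      by-case : (row e₂ ≡ a × col e₂ ≡ b × val e₂ ≡ v) ⊎ (e₂ ∈ entries 𝒯 × (color e₂ ≡ c → (row e₂ , col e₂) ≢ (a , b))) → ⊥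
      by-case (inj₁ (_ , _ , v₂≡)) = <⇒≢ t<v (trans (sym (proj₁ (,-injective eq₂))) v₂≡)
      by-case (inj₂ (e₂∈ , elsewhere)) = triple e₂∈ e₃∈ elsewhere
        (cellOf-≡ pt e₃∈ (≤-trans v≤a (m≤m+n a b)) eq₃)
        (cellOf-≡ pt e₂∈ (≤-trans (<⇒≤ t<v) (≤-trans v≤a (m≤m+n a b))) eq₂)

  -- Agreement to the left and below makes the entry of T′ a legal replacement in T, and its cell is
  -- occupied because both tableaux have the same cells. `no-raise` excludes this.
  not-below : ∀ {𝒯 𝒯′ c s T T′ a b} → IsStableFacet n D 𝒯 → IsPrismTableau D 𝒯′ → Φ n 𝒯 ≡ Φ n 𝒯′ →
    (s∈ : Nth D c s) → Nth 𝒯 c T → Nth 𝒯′ c T′ → InShape (proj₁ s) (proj₂ s) a b →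
    (∀ b′ → b ≡ suc b′ → InShape (proj₁ s) (proj₂ s) a b′ → at T a b′ ≡ at T′ a b′) →
    (InShape (proj₁ s) (proj₂ s) (suc a) b → at T (suc a) b ≡ at T′ (suc a) b) →
    ¬ (at T a b < at T′ a b)
  not-below {𝒯} {𝒯′} {c} {s} {T} {T′} {a} {b} st pt′ Φ≡ s∈ T∈ T′∈ in₀ left≡ below≡ t<t′ =
    no-raise st s∈ T∈ in₀ t<t′ (At.val≤row s∈ fil′ in₀)
      (setAt-filling fil in₀ v t<t′ (proj₂ (filling-bounds fil′ in₀)) left below)
      (faceOf-injective n (sym Φ≡) (cellOf-∈ pt′ e′∈) (occupied⁺ 𝒯′ e′∈))
    where
    open At s∈ hiding (val≤row)
    v = at T′ a b
    fil  = component (proj₁ st) s∈ T∈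
    fil′ = component pt′ s∈ T′∈
    e′∈ = entry-∈ pt′ s∈ T′∈ in₀
    left : ∀ b′ → b ≡ suc b′ → In a b′ → v ≤ at T a b′
    left b′ refl in′ = ≤-trans (filling-row fil′ in′ in₀) (≤-reflexive (sym (left≡ b′ refl in′)))
    below : In (suc a) b → v < at T (suc a) b
    below in′ = <-≤-trans (filling-col fil′ in₀ in′) (≤-reflexive (sym (below≡ in′)))

  Φ-injective : ∀ 𝒯 𝒯′ → IsStableFacet n D 𝒯 → IsStableFacet n D 𝒯′ → Φ n 𝒯 ≡ Φ n 𝒯′ → 𝒯 ≡ 𝒯′
  Φ-injective 𝒯 𝒯′ st st′ Φ≡ = Pointwise-≡ (proj₁ st) (proj₁ st′) same
    where
    same : ∀ {c s T T′} → Nth D c s → Nth 𝒯 c T → Nth 𝒯′ c T′ → T ≡ T′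
    same {c} {s} {T} {T′} s∈ T∈ T′∈ = At.filling-ext s∈ (component (proj₁ st) s∈ T∈) (component (proj₁ st′) s∈ T′∈)
      λ a b in′ → agree (proj₂ s ∸ a) b a (m+[n∸m]≡n (proj₁ (proj₂ in′))) in′
      where
      In = At.In s∈
      agree : ∀ k b a → a + k ≡ proj₂ s → In a b → at T a b ≡ at T′ a b
      agree k zero    a eq (_ , _ , () , _)
      agree k (suc b) a eq in₀ with <-cmp (at T a (suc b)) (at T′ a (suc b))
      ... | tri≈ _ t≡ _ = t≡
      ... | tri< t< _ _ = contradiction t< (not-below st (proj₁ st′) Φ≡ s∈ T∈ T′∈ in₀ left (below k eq))
        where
        left : ∀ b′ → suc b ≡ suc b′ → In a b′ → at T a b′ ≡ at T′ a b′
        left b′ refl = agree k b a eq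
        below : ∀ k → a + k ≡ proj₂ s → In (suc a) (suc b) → at T (suc a) (suc b) ≡ at T′ (suc a) (suc b)
        below zero    eq (_ , a<d , _) = contradiction (≤-reflexive (trans (sym eq) (+-identityʳ a))) (<⇒≱ a<d)
        below (suc k) eq = agree k (suc b) (suc a) (trans (sym (+-suc a k)) eq)
      ... | tri> _ _ t> = contradiction t> (not-below st′ (proj₁ st) (sym Φ≡) s∈ T′∈ T∈ in₀ left (below k eq))
        where
        left : ∀ b′ → suc b ≡ suc b′ → In a b′ → at T′ a b′ ≡ at T a b′
        left b′ refl in′ = sym (agree k b a eq in′)
        below : ∀ k → a + k ≡ proj₂ s → In (suc a) (suc b) → at T′ (suc a) (suc b) ≡ at T (suc a) (suc b)
        below zero    eq (_ , a<d , _) = contradiction (≤-reflexive (trans (sym eq) (+-identityʳ a))) (<⇒≱ a<d)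
        below (suc k) eq in′ = sym (agree k (suc b) (suc a) (trans (sym (+-suc a k)) eq) in′)

-- Weights

unique-same-length : ∀ {A : Set} {xs ys : List A} → Unique xs → Unique ys →
  (∀ {x} → x ∈ xs → x ∈ ys) → (∀ {x} → x ∈ ys → x ∈ xs) → length xs ≡ length ys
unique-same-length ux uy sub sub′ = ≤-antisym (unique-⊆-length ux sub) (unique-⊆-length uy sub′)

nub : List ℕ → List ℕ
nub = deduplicateᵇ _≡ᵇ_

nub-unique : ∀ xs → Unique (nub xs)
nub-unique []       = []
nub-unique (x ∷ xs) =
  All.map (λ {y} x≢ᵇy x≡y → x≢ᵇy (≡⇒≡ᵇ x y x≡y)) (Allₚ.all-filter _ (nub xs)) ∷ Uniqueₚ.filter⁺ _ (nub-unique xs)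

∈-nub⁺ : ∀ {xs z} → z ∈ xs → z ∈ nub xs
∈-nub⁺ = Anyₚ.deduplicate⁺ (λ x y → T? (x ≡ᵇ y)) λ y≡ᵇx z≡x → trans z≡x (sym (≡ᵇ⇒≡ _ _ y≡ᵇx))

∈-nub⁻ : ∀ xs {z} → z ∈ nub xs → z ∈ xs
∈-nub⁻ = ∈-deduplicate⁻ (λ x y → T? (x ≡ᵇ y))

sum-+ : ∀ (f g : ℕ → ℕ) xs → sum (map (λ x → f x + g x) xs) ≡ sum (map f xs) + sum (map g xs)
sum-+ f g []       = refl
sum-+ f g (x ∷ xs) = trans (cong (f x + g x +_) (sum-+ f g xs)) (interchange (f x) (g x) _ _)

sum-indicator-∉ : ∀ {i vs} → All (i ≢_) vs → sum (map (λ m → bit (i ≡ᵇ m)) vs) ≡ 0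
sum-indicator-∉ []          = refl
sum-indicator-∉ (i≢ ∷ rest) rewrite ≡ᵇ-false i≢ = sum-indicator-∉ rest

sum-indicator : ∀ {i vs} → Unique vs → i ∈ vs → sum (map (λ m → bit (i ≡ᵇ m)) vs) ≡ 1
sum-indicator {i} {v ∷ vs} (v∉ ∷ u) (here refl) rewrite ≡ᵇ-true {i} refl = cong suc (sum-indicator-∉ v∉)
sum-indicator {i} {v ∷ vs} (v∉ ∷ u) (there i∈) rewrite ≡ᵇ-false {i} {v} (λ i≡v → All.lookup v∉ i∈ (sym i≡v)) = sum-indicator u i∈

inRow : ℕ → Cell → Bool
inRow m c = proj₁ c ≡ᵇ m

sum-rows : ∀ {vs} cs → Unique vs → All (λ c → proj₁ c ∈ vs) cs → sum (map (λ m → countᵇ (inRow m) cs) vs) ≡ length cs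
sum-rows {vs} [] u [] = zeros vs
  where
  zeros : ∀ vs → sum (map (λ _ → 0) vs) ≡ 0
  zeros []       = refl
  zeros (_ ∷ vs) = zeros vs
sum-rows {vs} (c ∷ cs) u (c∈ ∷ cs∈) = begin
  sum (map (λ m → countᵇ (inRow m) (c ∷ cs)) vs)                 ≡⟨ cong sum (map-cong (λ m → countᵇ-∷ (inRow m) c cs) vs) ⟩
  sum (map (λ m → bit (inRow m c) + countᵇ (inRow m) cs) vs)     ≡⟨ sum-+ (λ m → bit (inRow m c)) (λ m → countᵇ (inRow m) cs) vs ⟩
  sum (map (λ m → bit (inRow m c)) vs) + sum (map (λ m → countᵇ (inRow m) cs) vs)
                                                                 ≡⟨ cong₂ _+_ (sum-indicator u c∈) (sum-rows cs u cs∈) ⟩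
  suc (length cs)                                                ∎
  where open ≡-Reasoning

-- The shear sending (i, j) to (i, i + j) turns the occupied cells into the pairs of a value and an
-- antidiagonal containing it. So the cells in row m correspond to the antidiagonals counted by the
-- exponent of x_m; `val≤` keeps the subtraction in `cellOf` exact.
module Weight (es : List Entry) (cs : List Cell) (cs-unique : Unique cs)
  (cs⁺ : ∀ {e} → e ∈ es → cellOf e ∈ cs) (cs⁻ : ∀ {c} → c ∈ cs → ∃ λ e → e ∈ es × cellOf e ≡ c)
  (val≤ : ∀ {e} → e ∈ es → val e ≤ antidiag e) where

  antidiagonals : ℕ → List ℕ
  antidiagonals m = nub (map antidiag (filterᵇ (λ e → val e ≡ᵇ m) es))

  ∈-antidiagonals⁺ : ∀ {e} → e ∈ es → antidiag e ∈ antidiagonals (val e)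
  ∈-antidiagonals⁺ {e} e∈ = ∈-nub⁺ (∈-map⁺ antidiag (∈-filter⁺ _ e∈ (≡⇒≡ᵇ (val e) _ refl)))

  ∈-antidiagonals⁻ : ∀ {m s} → s ∈ antidiagonals m → ∃ λ e → e ∈ es × val e ≡ m × antidiag e ≡ s
  ∈-antidiagonals⁻ {m} {s} s∈ with ∈-map⁻ antidiag (∈-nub⁻ (map antidiag (filterᵇ (λ e → val e ≡ᵇ m) es)) s∈)
  ... | e , e∈ , s≡ with ∈-filter⁻ (λ e → T? (val e ≡ᵇ m)) {xs = es} e∈
  ...   | e∈′ , v≡ = e , e∈′ , ≡ᵇ⇒≡ _ _ v≡ , sym s≡

  shear : Cell → Cell
  shear (i , j) = i , i + j

  shear-injective : ∀ {c c′} → shear c ≡ shear c′ → c ≡ c′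
  shear-injective {i , j} {i′ , j′} eq with ,-injective eq
  ... | refl , eq′ = cong (i ,_) (+-cancelˡ-≡ i j j′ eq′)

  shear-cellOf : ∀ {e} → e ∈ es → shear (cellOf e) ≡ (val e , antidiag e)
  shear-cellOf {e} e∈ = cong (val e ,_) (m+[n∸m]≡n (val≤ e∈))

  length-antidiagonals : ∀ m → length (antidiagonals m) ≡ countᵇ (inRow m) cs
  length-antidiagonals m = begin
    length (antidiagonals m)                           ≡⟨ length-map (m ,_) (antidiagonals m) ⟨
    length (map (m ,_) (antidiagonals m))              ≡⟨ unique-same-length
                                                            (Uniqueₚ.map⁺ (proj₂ ∘ ,-injective) (nub-unique (map antidiag (filterᵇ (λ e → val e ≡ᵇ m) es))))
                                                            (Uniqueₚ.map⁺ shear-injective (Uniqueₚ.filter⁺ (T? ∘ inRow m) cs-unique)) sub sub′ ⟩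
    length (map shear (filterᵇ (inRow m) cs))          ≡⟨ length-map shear (filterᵇ (inRow m) cs) ⟩
    countᵇ (inRow m) cs                                ∎
    where
    open ≡-Reasoning
    sub : ∀ {x} → x ∈ map (m ,_) (antidiagonals m) → x ∈ map shear (filterᵇ (inRow m) cs)
    sub x∈ with ∈-map⁻ (m ,_) x∈
    ... | s , s∈ , refl with ∈-antidiagonals⁻ s∈
    ...   | e , e∈ , refl , refl = subst (_∈ map shear (filterᵇ (inRow m) cs)) (shear-cellOf e∈)
      (∈-map⁺ shear (∈-filter⁺ (T? ∘ inRow m) (cs⁺ e∈) (≡⇒≡ᵇ m _ refl)))
    sub′ : ∀ {x} → x ∈ map shear (filterᵇ (inRow m) cs) → x ∈ map (m ,_) (antidiagonals m)
    sub′ x∈ with ∈-map⁻ shear x∈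
    ... | c , c∈ , refl with ∈-filter⁻ (T? ∘ inRow m) {xs = cs} c∈
    ...   | c∈′ , row≡ with cs⁻ c∈′
    ...     | e , e∈ , refl with ≡ᵇ⇒≡ (val e) m row≡
    ...       | refl = subst (_∈ map (val e ,_) (antidiagonals (val e))) (sym (shear-cellOf e∈)) (∈-map⁺ (val e ,_) (∈-antidiagonals⁺ e∈))

  -- The total degree runs only over values that occur, but by `cs⁻` every occupied cell lies in a
  -- row indexed by such a value.
  total : sum (map (λ m → length (antidiagonals m)) (nub (map val es))) ≡ length cs
  total = trans (cong sum (map-cong length-antidiagonals (nub (map val es))))
    (sum-rows cs (nub-unique (map val es)) (All.tabulate row∈))
    where
    row∈ : ∀ {c} → c ∈ cs → proj₁ c ∈ nub (map val es)
    row∈ c∈ with cs⁻ c∈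
    ... | e , e∈ , refl = ∈-nub⁺ (∈-map⁺ val e∈)

-- Dimension of faces and minimality of tableaux

dimension : Mask → ℕ
dimension = countᵇ (λ b → b)

dimension-faceOf : ∀ n p → countᵇ p (cellsQ n) + dimension (faceOf n p) ≡ n * n
dimension-faceOf n p = trans (cong (countᵇ p (cellsQ n) +_) (go (cellsQ n))) (trans (countᵇ-not p (cellsQ n)) (length-cellsQ n))
  where
  go : ∀ cs → dimension (map (not ∘ p) cs) ≡ countᵇ (not ∘ p) cs
  go []       = refl
  go (c ∷ cs) with not (p c)
  ... | true  = cong suc (go cs)
  ... | false = go cs

dimension-mono : ∀ {F G} → F ⊆ₘ G → dimension F ≤ dimension G
dimension-mono []                     = z≤n
dimension-mono (B.f≤t ∷ F⊆G)           = m≤n⇒m≤1+n (dimension-mono F⊆G)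
dimension-mono (B.b≤b {true}  ∷ F⊆G)   = s≤s (dimension-mono F⊆G)
dimension-mono (B.b≤b {false} ∷ F⊆G)   = dimension-mono F⊆G

⊆ₘ-dimension-≡ : ∀ {F G} → F ⊆ₘ G → dimension G ≤ dimension F → G ≡ F
⊆ₘ-dimension-≡ []                   _ = refl
⊆ₘ-dimension-≡ (B.f≤t ∷ F⊆G)         h = contradiction (≤-trans h (dimension-mono F⊆G)) (<⇒≱ (n<1+n _))
⊆ₘ-dimension-≡ (B.b≤b {true}  ∷ F⊆G) h = cong (true ∷_) (⊆ₘ-dimension-≡ F⊆G (s≤s⁻¹ h))
⊆ₘ-dimension-≡ (B.b≤b {false} ∷ F⊆G) h = cong (false ∷_) (⊆ₘ-dimension-≡ F⊆G h)

maxFace⇒facet : ∀ n D F → IsMaxFace n D F → IsFacet n D F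
maxFace⇒facet n D F (face , max) = face , λ G face′ F⊆G → ⊆ₘ-dimension-≡ F⊆G (max G face′)

module Minimality (n : ℕ) (D : Data) (valid : ValidData n D) where

  open PrismTableaux n D valid

  module _ {𝒯 : PrismTab} (pt : IsPrismTableau D 𝒯) where

    private
      occupiedCells : List Cell
      occupiedCells = filterᵇ (occupied 𝒯) (cellsQ n)

      module W = Weight (entries 𝒯) occupiedCells (Uniqueₚ.filter⁺ (T? ∘ occupied 𝒯) (cellsQ-unique n))
        (λ e∈ → ∈-filter⁺ (T? ∘ occupied 𝒯) (cellOf-∈ pt e∈) (occupied⁺ 𝒯 e∈))
        (λ c∈ → occupied⁻ 𝒯 (proj₂ (∈-filter⁻ (T? ∘ occupied 𝒯) {xs = cellsQ n} c∈)))
        (λ {e} e∈ → ≤-trans (val≤row pt e∈) (m≤m+n (row e) (col e)))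

    wtT≡wtF : ∀ m → wtT 𝒯 m ≡ wtF n (Φ n 𝒯) m
    wtT≡wtF m = trans (W.length-antidiagonals m) (cong (countᵇ (inRow m)) (sym (selected-complement n (occupied 𝒯))))

    totalDeg+dimension : totalDeg 𝒯 + dimension (Φ n 𝒯) ≡ n * n
    totalDeg+dimension = trans (cong (_+ dimension (Φ n 𝒯)) W.total) (dimension-faceOf n (occupied 𝒯))

  module _ {𝒯 𝒯′ : PrismTab} (pt : IsPrismTableau D 𝒯) (pt′ : IsPrismTableau D 𝒯′) where

    totalDeg-dimension : totalDeg 𝒯 ≤ totalDeg 𝒯′ ⇔ dimension (Φ n 𝒯′) ≤ dimension (Φ n 𝒯)
    totalDeg-dimension = antitone (totalDeg 𝒯) _ (totalDeg 𝒯′) _ (trans (totalDeg+dimension pt) (sym (totalDeg+dimension pt′)))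
      where
      antitone : ∀ a b a′ b′ → a + b ≡ a′ + b′ → a ≤ a′ ⇔ b′ ≤ b
      antitone a b a′ b′ eq = mk⇔
        (λ a≤a′ → +-cancelˡ-≤ a b′ b (≤-trans (+-monoˡ-≤ b′ a≤a′) (≤-reflexive (sym eq))))
        (λ b′≤b → +-cancelʳ-≤ b a a′ (≤-trans (≤-reflexive eq) (+-monoʳ-≤ a′ b′≤b)))

  -- Any face G is contained in the face of a greedy tableau. Minimality bounds the degree of that
  -- tableau from below, hence the size of its face, and with it that of G, from above.
  prism⇒maxFace : ∀ 𝒯 → IsPrism D 𝒯 → IsMaxFace n D (Φ n 𝒯)
  prism⇒maxFace 𝒯 (pt , minimal , _) = Φ-face pt , max
    where
    max : ∀ G → IsFace n D G → dimension G ≤ dimension (Φ n 𝒯)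
    max G face with face⇒predicate G face
    ... | p , refl , fill = ≤-trans (dimension-mono (covers⇒⊆ n (greedyTableau-covers p fill)))
      (to (totalDeg-dimension pt pt′) (minimal (greedyTableau p) pt′))
      where pt′ = greedyTableau-prism p fill

  prism⇒stable : ∀ 𝒯 → IsPrism D 𝒯 → IsStableFacet n D 𝒯
  prism⇒stable 𝒯 prism@(pt , _ , stable) = pt , maxFace⇒facet n D (Φ n 𝒯) (prism⇒maxFace 𝒯 prism) , stable

  maxFace⇒prism : ∀ F → IsMaxFace n D F → ∃ λ 𝒯 → IsPrism D 𝒯 × Φ n 𝒯 ≡ F
  maxFace⇒prism F maxF with facet⇒stable F (maxFace⇒facet n D F maxF)
  ... | 𝒯 , (pt , _ , stable) , refl = 𝒯 , (pt , minimal , stable) , refl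
    where
    minimal : IsMinimal D 𝒯
    minimal 𝒯′ pt′ = from (totalDeg-dimension pt pt′) (proj₂ maxF (Φ n 𝒯′) (Φ-face pt′))

-- In the second part injectivity is inherited: its first clause places the prism tableaux among the
-- stable facet tableaux, on which the first part makes `Φ` injective.
theorem4p16 : (n : ℕ) (D : Data) → ValidData n D →
    ((∀ 𝒯 → IsStableFacet n D 𝒯 → IsFacet n D (Φ n 𝒯)) ×
    (∀ 𝒯 𝒯′ → IsStableFacet n D 𝒯 → IsStableFacet n D 𝒯′ → Φ n 𝒯 ≡ Φ n 𝒯′ → 𝒯 ≡ 𝒯′) ×
    (∀ F → IsFacet n D F → ∃ λ 𝒯 → IsStableFacet n D 𝒯 × Φ n 𝒯 ≡ F) ×
    (∀ 𝒯 → IsStableFacet n D 𝒯 → ∀ m → wtT 𝒯 m ≡ wtF n (Φ n 𝒯) m)) ×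
    ((∀ 𝒯 → IsPrism D 𝒯 → IsStableFacet n D 𝒯) ×
    (∀ 𝒯 → IsPrism D 𝒯 → IsMaxFace n D (Φ n 𝒯)) ×
    (∀ F → IsMaxFace n D F → ∃ λ 𝒯 → IsPrism D 𝒯 × Φ n 𝒯 ≡ F))
theorem4p16 n D valid =
  ((λ _ → proj₁ ∘ proj₂) , Φ-injective , facet⇒stable , λ _ stable → wtT≡wtF (proj₁ stable)) ,
  (prism⇒stable , prism⇒maxFace , maxFace⇒prism)
  where
  open PrismTableaux n D valid
  open Minimality n D valid
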